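{- Let $n\ge2$ and $1\le k\le n$. With the operators below, $\mathrm{SVT}^n(\Lambda_k)$ is a K-crystal, i.e.: (K.1) the graph on $\mathrm{SVT}^n(\Lambda_k)$ with edges $T\to f_iT$ and $T\to f_i^KT$ (nonzero) is connected, and $u$ is the only element with $e_iu=0$ and $e_i^Ku=0$ for all $i$; (K.2) for every $w\in S_n$ the set $\mathrm{SVT}^n_w(\Lambda_k)$ does not depend on the choice of reduced expression of $w$; (K.3) for every $w\in S_n$ with reduced expression $w=s_{i_1}\cdots s_{i_\ell}$, \[\sum_{T\in\mathrm{SVT}^n_w(\Lambda_k)}\beta^{\mathrm{ex}(T)}x^{\mathrm{wt}(T)}=\varpi_{i_1}\cdots\varpi_{i_\ell}\,x_1x_2\cdots x_k,\] the Lascoux polynomial $L_{w\lambda}$ for $\lambda=(1^k,0^{n-k})$.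
   Context: $\mathrm{SVT}^n(\Lambda_k)$ is the set of single-column semistandard set-valued tableaux of height $k$ with entries at most $n$: sequences of nonempty sets $A_1,\dots,A_k\subseteq\{1,\dots,n\}$ (top to bottom) with $\max A_r<\min A_{r+1}$. $\mathrm{wt}(T)=(c_1,\dots,c_n)$, $c_j$ = number of boxes containing $j$; $\mathrm{ex}(T)=\sum_r(|A_r|-1)$. $u$ is the column $\{1\},\{2\},\dots,\{k\}$. For $1\le i<n$: $f_iT=0$ unless $i\in T$ and $i+1\notin T$, in which case $f_iT$ replaces $i$ by $i+1$; $e_iT=0$ unless $i+1\in T$ and $i\notin T$, in which case $e_iT$ replaces $i+1$ by $i$. K-crystal operators: $f_i^KT=0$ if $i\notin T$ or $i+1\in T$; otherwise $f_i^KT$ adds $i+1$ to the box containing $i$. $e_i^KT=0$ if no box contains both $i$ and $i+1$; otherwise $e_i^KT$ deletes $i+1$ from that box. For $g\in\{e_i,e_i^K\}$, $g^{\max}T=g^rT$ with $r$ maximal with $g^rT\ne 0$. K-Demazure crystal for a reduced expression $w=s_{i_1}\cdots s_{i_\ell}$: $\mathrm{SVT}^n_w(\Lambda_k)=\{T:(e^K_{i_\ell})^{\max}e_{i_\ell}^{\max}\cdots(e^K_{i_1})^{\max}e_{i_1}^{\max}T=u\}$ (rightmost operator applied first). Demazure--Lascoux operators: $\partial_if=(f-s_if)/(x_i-x_{i+1})$ ($s_i$ swaps $x_i,x_{i+1}$), $\varpi_if=\partial_i((x_i+\beta x_ix_{i+1})f)$. -}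

module Defs where

open import Data.Bool using (Bool; true; false; if_then_else_; _∧_; _∨_; not)
open import Data.Nat using (ℕ; zero; suc; _+_; _*_; _∸_; _≤_; _<_; _≡ᵇ_; _<ᵇ_)
open import Data.Integer as ℤ using (ℤ; +_; -_)
open import Data.Vec as V using (Vec; []; _∷_)
open import Data.List as L using (List; []; _∷_; filterᵇ; upTo; concatMap; length)
open import Data.List.Relation.Unary.All using (All)
open import Data.Maybe using (Maybe; just; nothing)
open import Data.Product using (Σ; _×_; _,_)
open import Data.Sum using (_⊎_)
open import Data.Fin using (Fin; toℕ)
open import Relation.Binary.PropositionalEquality using (_≡_)
open import Relation.Binary.Construct.Closure.Equivalence using (EqClosure)

-- Subsets of {1,…,n}: a box is a Vec Bool n, position p (0-based)
-- records whether the entry p+1 is present.  Entries are addressed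
-- by their 1-based value j : ℕ.

Box : ℕ → Set
Box n = Vec Bool n

memV : ∀ {n} → ℕ → Box n → Bool
memV j [] = false
memV zero (b ∷ A) = false
memV (suc zero) (b ∷ A) = b
memV (suc (suc j)) (b ∷ A) = memV (suc j) A

setV : ∀ {n} → ℕ → Bool → Box n → Box n
setV j c [] = []
setV zero c (b ∷ A) = b ∷ A
setV (suc zero) c (b ∷ A) = c ∷ A
setV (suc (suc j)) c (b ∷ A) = b ∷ setV (suc j) c A

anyV : ∀ {m} → Vec Bool m → Bool
anyV [] = false
anyV (b ∷ A) = b ∨ anyV A

countV : ∀ {m} → Vec Bool m → ℕ
countV [] = 0
countV (b ∷ A) = (if b then 1 else 0) + countV A

-- before A B  ⇔  every element of A is smaller than every element of B
-- (for nonempty A, B this is  max A < min B)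
before : ∀ {n} → Box n → Box n → Bool
before [] [] = true
before (a ∷ A) (b ∷ B) = if b then (not a ∧ not (anyV A)) else before A B

eqBox : ∀ {n} → Box n → Box n → Bool
eqBox [] [] = true
eqBox (a ∷ A) (b ∷ B) = (if a then b else not b) ∧ eqBox A B

-- Single-column set-valued tableaux of height k with entries ≤ n:
-- a vector of k boxes A₁,…,A_k (top to bottom).

Tab : ℕ → ℕ → Set
Tab n k = Vec (Box n) k

allNonempty : ∀ {n k} → Tab n k → Bool
allNonempty [] = true
allNonempty (A ∷ T) = anyV A ∧ allNonempty T

increasing : ∀ {n k} → Tab n k → Bool
increasing [] = true
increasing (A ∷ []) = true
increasing (A ∷ B ∷ T) = before A B ∧ increasing (B ∷ T)

validB : ∀ {n k} → Tab n k → Bool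
validB T = allNonempty T ∧ increasing T

Valid : ∀ {n k} → Tab n k → Set
Valid T = validB T ≡ true

eqTab : ∀ {n k} → Tab n k → Tab n k → Bool
eqTab [] [] = true
eqTab (A ∷ T) (B ∷ S) = eqBox A B ∧ eqTab T S

inT : ∀ {n k} → ℕ → Tab n k → Bool
inT j [] = false
inT j (A ∷ T) = memV j A ∨ inT j T

bothT : ∀ {n k} → ℕ → Tab n k → Bool
bothT i [] = false
bothT i (A ∷ T) = (memV i A ∧ memV (suc i) A) ∨ bothT i T

u : ∀ {n k} → Tab n k
u {n} {k} = V.tabulate (λ r → V.tabulate (λ p → toℕ p ≡ᵇ toℕ r))

-- Crystal and K-crystal operators (nothing = 0)

f : ∀ {n k} → ℕ → Tab n k → Maybe (Tab n k)
f i T = if inT i T ∧ not (inT (suc i) T)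
        then just (V.map (λ A → if memV i A then setV (suc i) true (setV i false A) else A) T)
        else nothing

e : ∀ {n k} → ℕ → Tab n k → Maybe (Tab n k)
e i T = if inT (suc i) T ∧ not (inT i T)
        then just (V.map (λ A → if memV (suc i) A then setV i true (setV (suc i) false A) else A) T)
        else nothing

fK : ∀ {n k} → ℕ → Tab n k → Maybe (Tab n k)
fK i T = if inT i T ∧ not (inT (suc i) T)
         then just (V.map (λ A → if memV i A then setV (suc i) true A else A) T)
         else nothing

eK : ∀ {n k} → ℕ → Tab n k → Maybe (Tab n k)
eK i T = if bothT i T
         then just (V.map (λ A → if memV i A ∧ memV (suc i) A then setV (suc i) false A else A) T)
         else nothing

iterMax : ∀ {n k} → (Tab n k → Maybe (Tab n k)) → ℕ → Tab n k → Tab n k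
iterMax g zero T = T
iterMax g (suc m) T with g T
... | nothing = T
... | just T′ = iterMax g m T′

-- For a valid tableau every application of e_i or e_i^K strictly
-- decreases the sum of all entries (which is ≤ n*n), so fuel n*n+1
-- makes iterMax compute exactly g^max.
gmax : ∀ {n k} → (Tab n k → Maybe (Tab n k)) → Tab n k → Tab n k
gmax {n} g T = iterMax g (suc (n * n)) T

demApply : ∀ {n k} → List ℕ → Tab n k → Tab n k
demApply [] T = T
demApply (i ∷ is) T = demApply is (gmax (eK i) (gmax (e i) T))

inDemB : ∀ {n k} → List ℕ → Tab n k → Bool
inDemB w T = eqTab (demApply w T) u

allBoxes : (n : ℕ) → List (Box n)
allBoxes zero = [] ∷ []
allBoxes (suc n) = concatMap (λ A → (true ∷ A) ∷ (false ∷ A) ∷ []) (allBoxes n)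

allTabs : (n k : ℕ) → List (Tab n k)
allTabs n zero = [] ∷ []
allTabs n (suc k) = concatMap (λ T → L.map (λ A → A ∷ T) (allBoxes n)) (allTabs n k)

SVT : (n k : ℕ) → List (Tab n k)
SVT n k = filterᵇ validB (allTabs n k)

SVTw : (n k : ℕ) → List ℕ → List (Tab n k)
SVTw n k w = filterᵇ (inDemB w) (SVT n k)

wt : ∀ {n k} → Tab n k → Vec ℕ n
wt {n} [] = V.replicate n 0
wt (A ∷ T) = V.zipWith (λ b c → if b then suc c else c) A (wt T)

ex : ∀ {n k} → Tab n k → ℕ
ex [] = 0
ex (A ∷ T) = (countV A ∸ 1) + ex T

Edge : (n k : ℕ) → Tab n k → Tab n k → Set
Edge n k T T′ = Σ ℕ λ i → (1 ≤ i × i < n) × (f i T ≡ just T′ ⊎ fK i T ≡ just T′)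

Connected : (n k : ℕ) → Set
Connected n k = (T T′ : Tab n k) → Valid T → Valid T′ → EqClosure (Edge n k) T T′

-- Words, the symmetric group, reduced expressions.
-- A word [i₁,…,i_ℓ] with 1 ≤ i_j < n represents s_{i₁}⋯s_{i_ℓ} ∈ S_n,
-- acting on {1,…,n} (s_i swaps i and i+1).

GoodWord : ℕ → List ℕ → Set
GoodWord n w = All (λ i → 1 ≤ i × i < n) w

sAct : ℕ → ℕ → ℕ
sAct i j = if j ≡ᵇ i then suc i else (if j ≡ᵇ suc i then i else j)

evalWord : List ℕ → ℕ → ℕ
evalWord [] j = j
evalWord (i ∷ w) j = sAct i (evalWord w j)

SamePerm : ℕ → List ℕ → List ℕ → Set
SamePerm n v w = (j : ℕ) → 1 ≤ j → j ≤ n → evalWord v j ≡ evalWord w j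

Reduced : ℕ → List ℕ → Set
Reduced n w = GoodWord n w × ((v : List ℕ) → GoodWord n v → SamePerm n v w → length w ≤ length v)

-- Polynomials in β, x₁,…,x_n with integer coefficients, as finite
-- lists of terms  c · β^b · x^a ; equality is equality of all coefficients.

Mono : ℕ → Set
Mono n = ℕ × Vec ℕ n

Poly : ℕ → Set
Poly n = List (ℤ × Mono n)

eqVecℕ : ∀ {m} → Vec ℕ m → Vec ℕ m → Bool
eqVecℕ [] [] = true
eqVecℕ (a ∷ A) (b ∷ B) = (a ≡ᵇ b) ∧ eqVecℕ A B

eqMono : ∀ {n} → Mono n → Mono n → Bool
eqMono (b , a) (b′ , a′) = (b ≡ᵇ b′) ∧ eqVecℕ a a′

coeff : ∀ {n} → Poly n → Mono n → ℤ
coeff [] m = + 0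
coeff ((c , m′) ∷ p) m = if eqMono m′ m then c ℤ.+ coeff p m else coeff p m

infix 4 _≈_
_≈_ : ∀ {n} → Poly n → Poly n → Set
p ≈ q = ∀ m → coeff p m ≡ coeff q m

infixl 6 _⊕_ _⊖_
infixl 7 _⊛_

_⊕_ : ∀ {n} → Poly n → Poly n → Poly n
p ⊕ q = p L.++ q

negP : ∀ {n} → Poly n → Poly n
negP = L.map (λ { (c , m) → (- c , m) })

_⊖_ : ∀ {n} → Poly n → Poly n → Poly n
p ⊖ q = p ⊕ negP q

mulMono : ∀ {n} → Mono n → Mono n → Mono n
mulMono (b , a) (b′ , a′) = (b + b′ , V.zipWith _+_ a a′)

_⊛_ : ∀ {n} → Poly n → Poly n → Poly n
p ⊛ q = concatMap (λ { (c , m) → L.map (λ { (c′ , m′) → (c ℤ.* c′ , mulMono m m′) }) q }) p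

oneP : ∀ {n} → Poly n
oneP {n} = (+ 1 , (0 , V.replicate n 0)) ∷ []

βP : ∀ {n} → Poly n
βP {n} = (+ 1 , (1 , V.replicate n 0)) ∷ []

xP : ∀ {n} → ℕ → Poly n
xP {n} j = (+ 1 , (0 , V.tabulate (λ p → if suc (toℕ p) ≡ᵇ j then 1 else 0))) ∷ []

monoP : ∀ {n} → ℕ → Vec ℕ n → Poly n
monoP b a = (+ 1 , (b , a)) ∷ []

getN : ∀ {m} → ℕ → Vec ℕ m → ℕ
getN j [] = 0
getN zero (a ∷ A) = 0
getN (suc zero) (a ∷ A) = a
getN (suc (suc j)) (a ∷ A) = getN (suc j) A

sP : ∀ {n} → ℕ → Poly n → Poly n
sP i = L.map (λ { (c , (b , a)) → (c , (b , V.tabulate (λ p → getN (sAct i (suc (toℕ p))) a))) })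

-- ϖ_i h = g, where ∂_i F = (F - s_i F)/(x_i - x_{i+1}) is the quotient
-- in ℤ[β,x₁,…,x_n] (an integral domain, so the quotient is unique):
IsVarpi : ∀ {n} → ℕ → Poly n → Poly n → Set
IsVarpi i h g =
  let F = (xP i ⊕ βP ⊛ xP i ⊛ xP (suc i)) ⊛ h
  in (xP i ⊖ xP (suc i)) ⊛ g ≈ F ⊖ sP i F

DLChain : ∀ {n} → List ℕ → Poly n → Poly n → Set
DLChain [] h g = g ≈ h
DLChain {n} (i ∷ is) h g = Σ (Poly n) λ g′ → DLChain is h g′ × IsVarpi i g′ g

xProd : ∀ {n} → ℕ → Poly n
xProd k = L.foldr _⊛_ oneP (L.map (λ j → xP (suc j)) (upTo k))

genPoly : (n k : ℕ) → List ℕ → Poly n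
genPoly n k w = L.foldr _⊕_ [] (L.map (λ T → monoP (ex T) (wt T)) (SVTw n k w))

K1 : (n k : ℕ) → Set
K1 n k = Connected n k
       × Valid (u {n} {k})
       × ((i : ℕ) → 1 ≤ i → i < n → e i (u {n} {k}) ≡ nothing × eK i (u {n} {k}) ≡ nothing)
       × ((T : Tab n k) → Valid T
            → ((i : ℕ) → 1 ≤ i → i < n → e i T ≡ nothing × eK i T ≡ nothing)
            → T ≡ u)

K2 : (n k : ℕ) → Set
K2 n k = (v w : List ℕ) → Reduced n v → Reduced n w → SamePerm n v w
       → (T : Tab n k) → Valid T → inDemB v T ≡ inDemB w T

K3 : (n k : ℕ) → Set
K3 n k = (w : List ℕ) → Reduced n w
       → Σ (Poly n) λ g → DLChain w (xProd k) g × genPoly n k w ≈ g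

{-# OPTIONS --safe #-}

-- A valid column T is a word in three letters, recording for each j ≤ n whether j is absent (○), the
-- minimum of its box (●), or a further entry of its box (◐).  The operators with index i only see the
-- letters i and i+1: the map T ↦ eᵢᴷᵐᵃˣ eᵢᵐᵃˣ T sends the words of each of the fibers {●○, ○●, ●◐} and
-- {◐○, ○◐, ◐◐} to the first one and fixes the words with ○○, ●● or ◐● in these places.
--
-- K.1: moving the letters to the left along these fibers connects every word to ●ᵏ○ⁿ⁻ᵏ.
-- K.2: eᵢᴷᵐᵃˣ eᵢᵐᵃˣ sorts the positions i and i+1 of the set of box maxima of T, so for reduced w
-- induction on the length gives: T lies in the Demazure crystal of w iff the set of box maxima is
-- componentwise at most w{1,…,k}.  The strong exchange condition supplies sᵢw > w in this induction.
-- K.3: the two lower elements of a fiber have the same box maxima.  Summing over fibers, the recursion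
-- for the generating functions reduces to ϖᵢ(xᵢ) = xᵢ + xᵢ₊₁ + β xᵢxᵢ₊₁, ϖᵢ(xᵢ₊₁ + β xᵢxᵢ₊₁) = 0 and
-- the linearity of ϖᵢ over polynomials symmetric in xᵢ and xᵢ₊₁.

module Submission where

open import Defs
open import Data.Bool using (Bool; true; false; if_then_else_; _∧_; _∨_; not; T)
open import Data.Bool.Properties using (∧-conicalˡ; ∧-conicalʳ; T-≡; T?)
open import Data.Empty using (⊥-elim)
open import Data.Fin using (toℕ)
open import Data.Integer as ℤ using (ℤ; +_; -_; _+_; _*_)
import Data.Integer.Properties as ℤ
open import Data.Integer.Tactic.RingSolver using (solve-∀)
open import Data.List as L using (List; []; _∷_; _++_; filterᵇ; concatMap; length; upTo)
import Data.List.Properties as L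
open import Data.List.Membership.Propositional using (_∈_; lose; find)
open import Data.List.Membership.Propositional.Properties
  using (∈-map⁺; ∈-map⁻; ∈-++⁺ˡ; ∈-++⁺ʳ; ∈-++⁻; ∈-concatMap⁺; ∈-concatMap⁻; ∈-filter⁺; ∈-filter⁻)
open import Data.List.Membership.Propositional.Properties.WithK using (unique∧set⇒bag)
open import Data.List.Relation.Binary.BagAndSetEquality using (∼bag⇒↭)
open import Data.List.Relation.Binary.Disjoint.Propositional using (Disjoint)
open import Data.List.Relation.Binary.Permutation.Propositional as Perm using (_↭_)
open import Data.List.Relation.Unary.All as All using (All; []; _∷_)
open import Data.List.Relation.Unary.AllPairs using ([]; _∷_)
open import Data.List.Relation.Unary.Any using (here; there)
open import Data.List.Relation.Unary.Unique.Propositional using (Unique)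
import Data.List.Relation.Unary.Unique.Propositional.Properties as Unique
open import Data.Maybe using (just; nothing)
open import Data.Nat as ℕ using (ℕ; zero; suc; _∸_; _≡ᵇ_; _≤ᵇ_; _≤_; _<_; z≤n; s≤s; _≟_)
import Data.Nat.Properties as ℕ
open import Data.Product using (Σ; ∃; _×_; _,_; proj₁; proj₂)
open import Data.Sum using (_⊎_; inj₁; inj₂)
open import Data.Vec as V using (Vec; []; _∷_)
import Data.Vec.Properties as V
open import Function using (_∘_)
open import Function.Bundles using (_⇔_; mk⇔; Equivalence)
open import Relation.Binary.Construct.Closure.Equivalence as Eq using (EqClosure)
open import Relation.Binary.Construct.Closure.ReflexiveTransitive as Star using (Star; ε; _◅_; _◅◅_)
open import Relation.Binary.Construct.Closure.Symmetric using (bwd)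
open import Relation.Binary.Definitions using (tri<; tri≈; tri>)
open import Relation.Binary.PropositionalEquality
open import Relation.Nullary using (¬_; contradiction; yes; no)

-- Words in the letters ○, ●, ◐ and their tableaux

variable
  q : Bool
  n k : ℕ

infixr 6 ○_ ●_ ◐_

-- The index k counts the ●s, and q tells whether the first entry is ◐, i.e. whether it
-- belongs to a box started further left; the codes of tableaux are those with q = false.
data Code : Bool → ℕ → ℕ → Set where
  ε  : Code false 0 0
  ○_ : Code q n k → Code q (suc n) k
  ●_ : Code q n k → Code false (suc n) (suc k)
  ◐_ : Code q n k → Code true (suc n) k

emptyBox : ∀ n → Box n
emptyBox n = V.replicate n false

shift : Tab n k → Tab (suc n) k
shift = V.map (false ∷_)

-- The entries ◐ before the first ●: the part inside the word of a box whose minimum lies further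
-- left. It is empty exactly for `q` = false.
lead : Code q n k → Box n
lead ε     = []
lead (○ t) = false ∷ lead t
lead (● t) = emptyBox _
lead (◐ t) = true ∷ lead t

dec : Code q n k → Tab n k
dec ε     = []
dec (○ t) = shift (dec t)
dec (● t) = (true ∷ lead t) ∷ shift (dec t)
dec (◐ t) = shift (dec t)

-- `dec` drops the entries ◐ before the first ●. Keeping them as an extra first box, possibly empty,
-- gives a form that determines the word and is suited to recursion on it.
decL : Code q n k → Tab n (suc k)
decL t = lead t ∷ dec t

lead-empty : (t : Code false n k) → lead t ≡ emptyBox n
lead-empty ε     = refl
lead-empty (○ t) = cong (false ∷_) (lead-empty t)
lead-empty (● t) = refl

decL-false : (t : Code false n k) → decL t ≡ emptyBox n ∷ dec t
decL-false t = cong (_∷ dec t) (lead-empty t)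

-- Positions and fibers

data Pos : ℕ → Set where
  here  : Pos (suc (suc n))
  there : Pos n → Pos (suc n)

idx : Pos n → ℕ
idx here      = 0
idx (there p) = suc (idx p)

-- The index i of the operators. Since `here` needs two letters, positions correspond to 1 ≤ i < n.
pos : Pos n → ℕ
pos p = suc (idx p)

position : ∀ {i} → 1 ≤ i → i < n → ∃ λ (p : Pos n) → pos p ≡ i
position {n = suc zero} {suc i} _ (s≤s ())
position {n = suc (suc n)} {suc zero} _ _ = here , refl
position {n = suc (suc n)} {suc (suc i)} _ (s≤s h) with position (s≤s z≤n) h
... | p , refl = there p , refl

pos<n : (p : Pos n) → pos p < n
pos<n here      = s≤s (s≤s z≤n)
pos<n (there p) = s≤s (pos<n p)

-- Fiber p a b c: e sends b to a and eᴷ sends c to a at position p.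
data Fiber : Pos n → Code q n k → Code q n k → Code q n k → Set where
  here●  : (t : Code q n k) → Fiber here (● ○ t) (○ ● t) (● ◐ t)
  here◐  : (t : Code q n k) → Fiber here (◐ ○ t) (○ ◐ t) (◐ ◐ t)
  there○ : ∀ {p : Pos n} {a b c : Code q n k} → Fiber p a b c → Fiber (there p) (○ a) (○ b) (○ c)
  there● : ∀ {p : Pos n} {a b c : Code q n k} → Fiber p a b c → Fiber (there p) (● a) (● b) (● c)
  there◐ : ∀ {p : Pos n} {a b c : Code q n k} → Fiber p a b c → Fiber (there p) (◐ a) (◐ b) (◐ c)

-- For ○○ neither entry is present; for ●● and ◐● both are, in different boxes. So no operator with
-- this index applies.
data Single : Pos n → Code q n k → Set where
  here○○ : (t : Code q n k) → Single here (○ ○ t)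
  here●● : (t : Code q n k) → Single here (● ● t)
  here◐● : (t : Code q n k) → Single here (◐ ● t)
  there○ : ∀ {p : Pos n} {a : Code q n k} → Single p a → Single (there p) (○ a)
  there● : ∀ {p : Pos n} {a : Code q n k} → Single p a → Single (there p) (● a)
  there◐ : ∀ {p : Pos n} {a : Code q n k} → Single p a → Single (there p) (◐ a)

data View (p : Pos n) : Code q n k → Set where
  single : {a : Code q n k} → Single p a → View p a
  top    : {a b c : Code q n k} → Fiber p a b c → View p a
  mid    : {a b c : Code q n k} → Fiber p a b c → View p b
  bot    : {a b c : Code q n k} → Fiber p a b c → View p c

view : (p : Pos n) (t : Code q n k) → View p t
view here (○ ○ t) = single (here○○ t)
view here (○ ● t) = mid (here● t)
view here (○ ◐ t) = mid (here◐ t)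
view here (● ○ t) = top (here● t)
view here (● ● t) = single (here●● t)
view here (● ◐ t) = bot (here● t)
view here (◐ ○ t) = top (here◐ t)
view here (◐ ● t) = single (here◐● t)
view here (◐ ◐ t) = bot (here◐ t)
view (there p) (○ t) with view p t
... | single x = single (there○ x)
... | top x = top (there○ x)
... | mid x = mid (there○ x)
... | bot x = bot (there○ x)
view (there p) (● t) with view p t
... | single x = single (there● x)
... | top x = top (there● x)
... | mid x = mid (there● x)
... | bot x = bot (there● x)
view (there p) (◐ t) with view p t
... | single x = single (there◐ x)
... | top x = top (there◐ x)
... | mid x = mid (there◐ x)
... | bot x = bot (there◐ x)

-- Crystal operators on codes

memV-empty : ∀ j n → memV j (emptyBox n) ≡ false
memV-empty j             zero    = refl
memV-empty zero          (suc n) = refl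
memV-empty (suc zero)    (suc n) = refl
memV-empty (suc (suc j)) (suc n) = memV-empty (suc j) n

inT-shift : ∀ j (T : Tab n k) → inT (suc (suc j)) (shift T) ≡ inT (suc j) T
inT-shift j []      = refl
inT-shift j (A ∷ T) = cong (memV (suc j) A ∨_) (inT-shift j T)

bothT-shift : ∀ j (T : Tab n k) → bothT (suc (suc j)) (shift T) ≡ bothT (suc j) T
bothT-shift j []      = refl
bothT-shift j (A ∷ T) = cong ((memV (suc j) A ∧ memV (suc (suc j)) A) ∨_) (bothT-shift j T)

-- The three tests on which the definitions of the four operators branch.
status : ℕ → Tab n k → Bool × Bool × Bool
status i T = inT i T , inT (suc i) T , bothT i T

triple : ∀ {x x′ y y′ z z′ : Bool} → x ≡ x′ → y ≡ y′ → z ≡ z′ → (x , y , z) ≡ (x′ , y′ , z′)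
triple refl refl refl = refl

status-shift : ∀ j (T : Tab n k) → status (suc (suc j)) (shift T) ≡ status (suc j) T
status-shift j T = triple (inT-shift j T) (inT-shift (suc j) T) (bothT-shift j T)

status-empty : ∀ j (T : Tab n k) → status j (emptyBox n ∷ T) ≡ status j T
status-empty {n} j T rewrite memV-empty j n | memV-empty (suc j) n = refl

inT-1-shift : (T : Tab n k) → inT 1 (shift T) ≡ false
inT-1-shift []      = refl
inT-1-shift (A ∷ T) = inT-1-shift T

bothT-1-shift : (T : Tab n k) → bothT 1 (shift T) ≡ false
bothT-1-shift []      = refl
bothT-1-shift (A ∷ T) = bothT-1-shift T

inT-2-shift : (T : Tab n k) → inT 2 (shift (shift T)) ≡ false
inT-2-shift T = trans (inT-shift 0 (shift T)) (inT-1-shift T)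

status-○ : ∀ j (t : Code q n k) → status (suc (suc j)) (decL (○ t)) ≡ status (suc j) (decL t)
status-○ j t = status-shift j (decL t)

status-◐ : ∀ j (t : Code q n k) → status (suc (suc j)) (decL (◐ t)) ≡ status (suc j) (decL t)
status-◐ j t = status-shift j (decL t)

status-● : ∀ j (t : Code q n k) → status (suc (suc j)) (decL (● t)) ≡ status (suc j) (decL t)
status-● {n = n} j t = trans (status-empty (suc (suc j)) (dec (● t))) (status-shift j (decL t))

status-top : {p : Pos n} {a b c : Code q n k} → Fiber p a b c →
             status (pos p) (decL a) ≡ (true , false , false)
status-top (here● t)  = triple refl (inT-2-shift (dec t)) (bothT-1-shift (shift (dec t)))
status-top (here◐ t)  = triple refl (inT-2-shift (dec t)) (bothT-1-shift (shift (dec t)))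
status-top (there○ {p = p} {a} x) = trans (status-○ (idx p) a) (status-top x)
status-top (there● {p = p} {a} x) = trans (status-● (idx p) a) (status-top x)
status-top (there◐ {p = p} {a} x) = trans (status-◐ (idx p) a) (status-top x)

status-mid : {p : Pos n} {a b c : Code q n k} → Fiber p a b c →
             status (pos p) (decL b) ≡ (false , true , false)
status-mid (here● t)  = triple (inT-1-shift (shift (dec t))) refl (bothT-1-shift (shift (dec t)))
status-mid (here◐ t)  = triple (inT-1-shift (shift (dec t))) refl (bothT-1-shift (shift (dec t)))
status-mid (there○ {p = p} {b = b} x) = trans (status-○ (idx p) b) (status-mid x)
status-mid (there● {p = p} {b = b} x) = trans (status-● (idx p) b) (status-mid x)
status-mid (there◐ {p = p} {b = b} x) = trans (status-◐ (idx p) b) (status-mid x)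

status-bot : {p : Pos n} {a b c : Code q n k} → Fiber p a b c →
             status (pos p) (decL c) ≡ (true , true , true)
status-bot (here● t)  = refl
status-bot (here◐ t)  = refl
status-bot (there○ {p = p} {c = c} x) = trans (status-○ (idx p) c) (status-bot x)
status-bot (there● {p = p} {c = c} x) = trans (status-● (idx p) c) (status-bot x)
status-bot (there◐ {p = p} {c = c} x) = trans (status-◐ (idx p) c) (status-bot x)

status-single : {p : Pos n} {a : Code q n k} → Single p a →
                ∃ λ x → status (pos p) (decL a) ≡ (x , x , false)
status-single (here○○ t) =
  false , triple (inT-1-shift (shift (dec t))) (inT-2-shift (dec t)) (bothT-1-shift (shift (dec t)))
status-single (here●● t) = true , triple refl refl (bothT-1-shift (shift (dec t)))
status-single (here◐● t) = true , triple refl refl (bothT-1-shift (shift (dec t)))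
status-single (there○ {p = p} {a} s) with status-single s
... | x , eq = x , trans (status-○ (idx p) a) eq
status-single (there● {p = p} {a} s) with status-single s
... | x , eq = x , trans (status-● (idx p) a) eq
status-single (there◐ {p = p} {a} s) with status-single s
... | x , eq = x , trans (status-◐ (idx p) a) eq

-- Each operator is a guard, decided by `status`, followed by one map applied to every box. The box
-- maps are studied here without the guards.
BoxOp : Set
BoxOp = ∀ {n} → ℕ → Box n → Box n

eBox fBox eKBox fKBox : BoxOp
eBox  i A = if memV (suc i) A then setV i true (setV (suc i) false A) else A
fBox  i A = if memV i A then setV (suc i) true (setV i false A) else A
eKBox i A = if memV i A ∧ memV (suc i) A then setV (suc i) false A else A
fKBox i A = if memV i A then setV (suc i) true A else A

-- What is needed to push a box map through `shift`: index 1 acts trivially on boxes containing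
-- neither 1 nor 2, and a larger index ignores the first entry.
record Local (g : BoxOp) : Set where
  field
    at-1   : ∀ {n} (A : Box n) → g 1 (false ∷ false ∷ A) ≡ false ∷ false ∷ A
    at-2+j : ∀ {n} j b (A : Box n) → g (suc (suc j)) (b ∷ A) ≡ b ∷ g (suc j) A

eBox-local : Local eBox
eBox-local = record { at-1 = λ A → refl ; at-2+j = λ j b A → rec j b A }
  where
    rec : ∀ {n} j b (A : Box n) → eBox (suc (suc j)) (b ∷ A) ≡ b ∷ eBox (suc j) A
    rec j b A with memV (suc (suc j)) A
    ... | true  = refl
    ... | false = refl

fBox-local : Local fBox
fBox-local = record { at-1 = λ A → refl ; at-2+j = λ j b A → rec j b A }
  where
    rec : ∀ {n} j b (A : Box n) → fBox (suc (suc j)) (b ∷ A) ≡ b ∷ fBox (suc j) A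
    rec j b A with memV (suc j) A
    ... | true  = refl
    ... | false = refl

eKBox-local : Local eKBox
eKBox-local = record { at-1 = λ A → refl ; at-2+j = λ j b A → rec j b A }
  where
    rec : ∀ {n} j b (A : Box n) → eKBox (suc (suc j)) (b ∷ A) ≡ b ∷ eKBox (suc j) A
    rec j b A with memV (suc j) A ∧ memV (suc (suc j)) A
    ... | true  = refl
    ... | false = refl

fKBox-local : Local fKBox
fKBox-local = record { at-1 = λ A → refl ; at-2+j = λ j b A → rec j b A }
  where
    rec : ∀ {n} j b (A : Box n) → fKBox (suc (suc j)) (b ∷ A) ≡ b ∷ fKBox (suc j) A
    rec j b A with memV (suc j) A
    ... | true  = refl
    ... | false = refl

module _ {g : BoxOp} (loc : Local g) where
  open Local loc

  map-shift : ∀ j (T : Tab n k) →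
              V.map (g (suc (suc j))) (shift T) ≡ shift (V.map (g (suc j)) T)
  map-shift j []      = refl
  map-shift j (A ∷ T) = cong₂ _∷_ (at-2+j j false A) (map-shift j T)

  map-shift² : (T : Tab n k) → V.map (g 1) (shift (shift T)) ≡ shift (shift T)
  map-shift² []      = refl
  map-shift² (A ∷ T) = cong₂ _∷_ (at-1 A) (map-shift² T)

  op-empty : (p : Pos n) → g (pos p) (emptyBox n) ≡ emptyBox n
  op-empty here      = at-1 _
  op-empty (there p) = trans (at-2+j (idx p) false _) (cong (false ∷_) (op-empty p))

-- A record rather than a bare equation, so that `p`, `a` and `b` can be inferred from the type.
record Maps (g : BoxOp) (p : Pos n) (a b : Code q n k) : Set where
  constructor maps
  field map-decL : V.map (g (pos p)) (decL a) ≡ decL b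

module _ {g : BoxOp} (loc : Local g) where
  open Local loc

  maps-● : {p : Pos n} {a b : Code q n k} → Maps g p a b → Maps g (there p) (● a) (● b)
  maps-● {p = p} {a} (maps eq) = maps (cong₂ _∷_ (op-empty loc (there p)) (cong₂ _∷_
    (trans (at-2+j (idx p) true (lead a)) (cong (true ∷_) (V.∷-injectiveˡ eq)))
    (trans (map-shift loc (idx p) (dec a)) (cong shift (V.∷-injectiveʳ eq)))))

  maps-○ : {p : Pos n} {a b : Code q n k} → Maps g p a b → Maps g (there p) (○ a) (○ b)
  maps-○ {p = p} {a} (maps eq) = maps (trans (map-shift loc (idx p) (decL a)) (cong shift eq))

  -- `decL (◐ a)` is `dec (● a)`, so this is the case of ● with the empty first box removed.
  maps-◐ : {p : Pos n} {a b : Code q n k} → Maps g p a b → Maps g (there p) (◐ a) (◐ b)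
  maps-◐ m with maps-● m
  ... | maps eq = maps (V.∷-injectiveʳ eq)

maps-e : {p : Pos n} {a b c : Code q n k} → Fiber p a b c → Maps eBox p b a
maps-e (here● t) = maps (cong₂ _∷_ refl (cong₂ _∷_ refl (map-shift² eBox-local (dec t))))
maps-e (here◐ t) = maps (cong₂ _∷_ refl (map-shift² eBox-local (dec t)))
maps-e (there○ x) = maps-○ eBox-local (maps-e x)
maps-e (there● x) = maps-● eBox-local (maps-e x)
maps-e (there◐ x) = maps-◐ eBox-local (maps-e x)

maps-f : {p : Pos n} {a b c : Code q n k} → Fiber p a b c → Maps fBox p a b
maps-f (here● t) = maps (cong₂ _∷_ refl (cong₂ _∷_ refl (map-shift² fBox-local (dec t))))
maps-f (here◐ t) = maps (cong₂ _∷_ refl (map-shift² fBox-local (dec t)))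
maps-f (there○ x) = maps-○ fBox-local (maps-f x)
maps-f (there● x) = maps-● fBox-local (maps-f x)
maps-f (there◐ x) = maps-◐ fBox-local (maps-f x)

maps-eK : {p : Pos n} {a b c : Code q n k} → Fiber p a b c → Maps eKBox p c a
maps-eK (here● t) = maps (cong₂ _∷_ refl (cong₂ _∷_ refl (map-shift² eKBox-local (dec t))))
maps-eK (here◐ t) = maps (cong₂ _∷_ refl (map-shift² eKBox-local (dec t)))
maps-eK (there○ x) = maps-○ eKBox-local (maps-eK x)
maps-eK (there● x) = maps-● eKBox-local (maps-eK x)
maps-eK (there◐ x) = maps-◐ eKBox-local (maps-eK x)

maps-fK : {p : Pos n} {a b c : Code q n k} → Fiber p a b c → Maps fKBox p a c
maps-fK (here● t) = maps (cong₂ _∷_ refl (cong₂ _∷_ refl (map-shift² fKBox-local (dec t))))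
maps-fK (here◐ t) = maps (cong₂ _∷_ refl (map-shift² fKBox-local (dec t)))
maps-fK (there○ x) = maps-○ fKBox-local (maps-fK x)
maps-fK (there● x) = maps-● fKBox-local (maps-fK x)
maps-fK (there◐ x) = maps-◐ fKBox-local (maps-fK x)

status-dec : ∀ i (t : Code false n k) → status i (decL t) ≡ status i (dec t)
status-dec i t = trans (cong (status i) (decL-false t)) (status-empty i (dec t))

module _ (i : ℕ) (T : Tab n k) where

  ops-top : status i T ≡ (true , false , false) →
            e i T ≡ nothing × eK i T ≡ nothing ×
            f i T ≡ just (V.map (fBox i) T) × fK i T ≡ just (V.map (fKBox i) T)
  ops-top eq with inT i T | inT (suc i) T | bothT i T
  ops-top refl | _ | _ | _ = refl , refl , refl , refl

  ops-mid : status i T ≡ (false , true , false) → e i T ≡ just (V.map (eBox i) T)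
  ops-mid eq with inT i T | inT (suc i) T | bothT i T
  ops-mid refl | _ | _ | _ = refl

  ops-bot : status i T ≡ (true , true , true) → e i T ≡ nothing × eK i T ≡ just (V.map (eKBox i) T)
  ops-bot eq with inT i T | inT (suc i) T | bothT i T
  ops-bot refl | _ | _ | _ = refl , refl

  ops-single : ∀ {x} → status i T ≡ (x , x , false) → e i T ≡ nothing × eK i T ≡ nothing
  ops-single eq with inT i T | inT (suc i) T | bothT i T
  ops-single {false} refl | _ | _ | _ = refl , refl
  ops-single {true}  refl | _ | _ | _ = refl , refl

module _ {p : Pos n} {a b c : Code false n k} (x : Fiber p a b c) where

  private
    top′ = ops-top (pos p) (dec a) (trans (sym (status-dec (pos p) a)) (status-top x))
    bot′ = ops-bot (pos p) (dec c) (trans (sym (status-dec (pos p) c)) (status-bot x))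

  e-top : e (pos p) (dec a) ≡ nothing
  e-top = proj₁ top′

  eK-top : eK (pos p) (dec a) ≡ nothing
  eK-top = proj₁ (proj₂ top′)

  f-top : f (pos p) (dec a) ≡ just (dec b)
  f-top = trans (proj₁ (proj₂ (proj₂ top′))) (cong just (V.∷-injectiveʳ (Maps.map-decL (maps-f x))))

  fK-top : fK (pos p) (dec a) ≡ just (dec c)
  fK-top = trans (proj₂ (proj₂ (proj₂ top′))) (cong just (V.∷-injectiveʳ (Maps.map-decL (maps-fK x))))

  e-mid : e (pos p) (dec b) ≡ just (dec a)
  e-mid = trans (ops-mid (pos p) (dec b) (trans (sym (status-dec (pos p) b)) (status-mid x)))
                (cong just (V.∷-injectiveʳ (Maps.map-decL (maps-e x))))

  e-bot : e (pos p) (dec c) ≡ nothing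
  e-bot = proj₁ bot′

  eK-bot : eK (pos p) (dec c) ≡ just (dec a)
  eK-bot = trans (proj₂ bot′) (cong just (V.∷-injectiveʳ (Maps.map-decL (maps-eK x))))

e-eK-single : {p : Pos n} {a : Code false n k} → Single p a →
              e (pos p) (dec a) ≡ nothing × eK (pos p) (dec a) ≡ nothing
e-eK-single {p = p} {a} s with status-single s
... | _ , eq = ops-single (pos p) (dec a) (trans (sym (status-dec (pos p) a)) eq)

-- The map eᵢᴷᵐᵃˣ eᵢᵐᵃˣ on fibers and single words

iterMax-nothing : ∀ (g : Tab n k → _) m {T} → g T ≡ nothing → iterMax g m T ≡ T
iterMax-nothing g zero eq = refl
iterMax-nothing g (suc m) eq rewrite eq = refl

gmax-nothing : ∀ (g : Tab n k → _) {T} → g T ≡ nothing → gmax g T ≡ T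
gmax-nothing {n} g = iterMax-nothing g (suc (n ℕ.* n))

-- On a fiber `e` and `eK` each apply at most once, so it is enough that the fuel is positive.
gmax-just : ∀ (g : Tab n k → _) {T T′} → g T ≡ just T′ → g T′ ≡ nothing → gmax g T ≡ T′
gmax-just {n} g eq eq′ rewrite eq = iterMax-nothing g (n ℕ.* n) eq′

lower : ℕ → Tab n k → Tab n k
lower i T = gmax (eK i) (gmax (e i) T)

lower-fixed : ∀ i {T : Tab n k} → e i T ≡ nothing → eK i T ≡ nothing → lower i T ≡ T
lower-fixed i eq eq′ =
  trans (cong (gmax (eK i)) (gmax-nothing (e i) eq)) (gmax-nothing (eK i) eq′)

lower-single : {p : Pos n} {a : Code false n k} → Single p a → lower (pos p) (dec a) ≡ dec a
lower-single {p = p} s with e-eK-single s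
... | eq , eq′ = lower-fixed (pos p) eq eq′

module _ {p : Pos n} {a b c : Code false n k} (x : Fiber p a b c) where

  lower-top : lower (pos p) (dec a) ≡ dec a
  lower-top = lower-fixed (pos p) (e-top x) (eK-top x)

  lower-mid : lower (pos p) (dec b) ≡ dec a
  lower-mid = trans (cong (gmax (eK (pos p))) (gmax-just (e (pos p)) (e-mid x) (e-top x)))
                    (gmax-nothing (eK (pos p)) (eK-top x))

  lower-bot : lower (pos p) (dec c) ≡ dec a
  lower-bot = trans (cong (gmax (eK (pos p))) (gmax-nothing (e (pos p)) (e-bot x)))
                    (gmax-just (eK (pos p)) (eK-bot x) (eK-top x))

-- Codes enumerate the valid tableaux

anyV-empty : ∀ n → anyV (emptyBox n) ≡ false
anyV-empty zero    = refl
anyV-empty (suc n) = anyV-empty n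

anyV-false : (A : Box n) → anyV A ≡ false → A ≡ emptyBox n
anyV-false []          _  = refl
anyV-false (false ∷ A) eq = cong (false ∷_) (anyV-false A eq)

before-empty : (B : Box n) → before (emptyBox n) B ≡ true
before-empty []                  = refl
before-empty {suc n} (true ∷ B)  = cong not (anyV-empty n)
before-empty {suc n} (false ∷ B) = before-empty B

allNonempty-shift : (T : Tab n k) → allNonempty (shift T) ≡ allNonempty T
allNonempty-shift []      = refl
allNonempty-shift (A ∷ T) = cong (anyV A ∧_) (allNonempty-shift T)

increasing-shift : ∀ x (A : Box n) (T : Tab n k) → increasing ((x ∷ A) ∷ shift T) ≡ increasing (A ∷ T)
increasing-shift x A []      = refl
increasing-shift x A (B ∷ T) = cong (before A B ∧_) (increasing-shift false B T)

increasing-empty : (T : Tab n k) → increasing (emptyBox n ∷ T) ≡ increasing T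
increasing-empty []      = refl
increasing-empty (B ∷ T) = cong (_∧ increasing (B ∷ T)) (before-empty B)

increasing-tail : (A : Box n) (T : Tab n k) → increasing (A ∷ T) ≡ true → increasing T ≡ true
increasing-tail A []      _ = refl
increasing-tail A (B ∷ T) h = ∧-conicalʳ (before A B) _ h

dec-allNonempty : (t : Code q n k) → allNonempty (dec t) ≡ true
dec-allNonempty ε     = refl
dec-allNonempty (○ t) = trans (allNonempty-shift (dec t)) (dec-allNonempty t)
dec-allNonempty (● t) = trans (allNonempty-shift (dec t)) (dec-allNonempty t)
dec-allNonempty (◐ t) = trans (allNonempty-shift (dec t)) (dec-allNonempty t)

decL-increasing : (t : Code q n k) → increasing (decL t) ≡ true
decL-increasing ε     = refl
decL-increasing (○ t) = trans (increasing-shift false (lead t) (dec t)) (decL-increasing t)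
decL-increasing (● t) = trans (increasing-empty ((true ∷ lead t) ∷ shift (dec t)))
  (trans (increasing-shift true (lead t) (dec t)) (decL-increasing t))
decL-increasing (◐ t) = trans (increasing-shift true (lead t) (dec t)) (decL-increasing t)

dec-valid : (t : Code q n k) → Valid (dec t)
dec-valid t = cong₂ _∧_ (dec-allNonempty t) (increasing-tail (lead t) (dec t) (decL-increasing t))

before-true : (A : Box (suc n)) {B : Box n} → before A (true ∷ B) ≡ true → anyV A ≡ false
before-true (false ∷ A) h with anyV A
before-true (false ∷ A) h | false = refl

unshift : (A : Box (suc n)) (T : Tab (suc n) k) → anyV A ≡ true → allNonempty T ≡ true →
          increasing (A ∷ T) ≡ true → ∃ λ T′ → T ≡ shift T′
unshift A [] _ _ _ = [] , refl
unshift A ((true ∷ B) ∷ T) a _ inc =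
  contradiction (trans (sym a) (before-true A (∧-conicalˡ _ _ inc))) λ ()
unshift A ((false ∷ B) ∷ T) _ ne inc
  with unshift (false ∷ B) T (∧-conicalˡ _ _ ne) (∧-conicalʳ (anyV B) _ ne) (∧-conicalʳ (before A (false ∷ B)) _ inc)
... | T′ , refl = B ∷ T′ , refl

-- Reads the word from left to right, with `A` the remaining part of the box begun earlier. If the
-- first box of `T` contains 1, then `A` is empty and the letter is ●; otherwise the letter is ◐ or
-- ○ according to the first place of `A`.
enc : (A : Box n) (T : Tab n k) → allNonempty T ≡ true → increasing (A ∷ T) ≡ true →
      ∃ λ q → Σ (Code q n k) λ t → decL t ≡ A ∷ T

enc-shift : ∀ a (A : Box n) (T : Tab n k) → allNonempty T ≡ true → increasing (A ∷ T) ≡ true →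
            ∃ λ q → Σ (Code q (suc n) k) λ t → decL t ≡ (a ∷ A) ∷ shift T

enc [] []       _ _ = false , ε , refl
enc [] ([] ∷ T) () _
enc (a ∷ A) []  _ _ = enc-shift a A [] refl refl
enc (a ∷ A) ((false ∷ B) ∷ T) ne inc
  with unshift (false ∷ B) T (∧-conicalˡ _ _ ne) (∧-conicalʳ (anyV B) _ ne) (∧-conicalʳ (before A B) _ inc)
... | T′ , refl = enc-shift a A (B ∷ T′)
      (trans (sym (cong (anyV B ∧_) (allNonempty-shift T′))) ne)
      (trans (sym (increasing-shift a A (B ∷ T′))) inc)
enc (a ∷ A) ((true ∷ B) ∷ T) ne inc
  with unshift (true ∷ B) T refl ne (∧-conicalʳ (before (a ∷ A) (true ∷ B)) _ inc)
... | T′ , refl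
  with enc B T′ (trans (sym (allNonempty-shift T′)) ne)
         (trans (sym (increasing-shift true B T′)) (∧-conicalʳ (before (a ∷ A) (true ∷ B)) _ inc))
... | q , t , eq = false , ● t , cong₂ _∷_
      (sym (anyV-false (a ∷ A) (before-true (a ∷ A) {B} (∧-conicalˡ _ _ inc))))
      (cong₂ _∷_ (cong (true ∷_) (V.∷-injectiveˡ eq)) (cong shift (V.∷-injectiveʳ eq)))

enc-shift a A T ne inc with enc A T ne inc
enc-shift false A T ne inc | q , t , eq = q , ○ t , cong shift eq
enc-shift true  A T ne inc | q , t , eq =
  true , ◐ t , cong₂ _∷_ (cong (true ∷_) (V.∷-injectiveˡ eq)) (cong shift (V.∷-injectiveʳ eq))

lead-true : (t : Code true n k) → ¬ lead t ≡ emptyBox n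
lead-true (○ t) eq = lead-true t (V.∷-injectiveʳ eq)

dec-surjective : (T : Tab n k) → Valid T → Σ (Code false n k) λ t → dec t ≡ T
dec-surjective T v with enc (emptyBox _) T (∧-conicalˡ _ _ v)
                          (trans (increasing-empty T) (∧-conicalʳ (allNonempty T) _ v))
... | false , t , eq = t , V.∷-injectiveʳ eq
... | true  , t , eq = contradiction (V.∷-injectiveˡ eq) (lead-true t)

shift-injective : {T T′ : Tab n k} → shift T ≡ shift T′ → T ≡ T′
shift-injective {T = []}    {[]}     _  = refl
shift-injective {T = A ∷ T} {B ∷ T′} eq =
  cong₂ _∷_ (V.∷-injectiveʳ (V.∷-injectiveˡ eq)) (shift-injective (V.∷-injectiveʳ eq))

shift≢true∷ : (T : Tab n (suc k)) {A : Box n} {S : Tab (suc n) k} → ¬ shift T ≡ (true ∷ A) ∷ S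
shift≢true∷ (B ∷ T) eq with V.∷-injectiveˡ (V.∷-injectiveˡ eq)
... | ()

-- The first letter is ● iff the second box contains 1, and ◐ iff the first box does. The words may
-- differ in `q` a priori, so the conclusion equates pairs.
decL-injective : ∀ {q q′} (t : Code q n k) (t′ : Code q′ n k) → decL t ≡ decL t′ →
                 _≡_ {A = Σ Bool λ q → Code q n k} (q , t) (q′ , t′)
decL-injective ε ε _ = refl
decL-injective (○ t) (○ t′) eq with decL-injective t t′ (shift-injective eq)
... | refl = refl
decL-injective (● t) (● t′) eq with decL-injective t t′ (cong₂ _∷_
    (V.∷-injectiveʳ (V.∷-injectiveˡ (V.∷-injectiveʳ eq)))
    (shift-injective (V.∷-injectiveʳ (V.∷-injectiveʳ eq))))
... | refl = refl
decL-injective (◐ t) (◐ t′) eq with decL-injective t t′ (cong₂ _∷_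
    (V.∷-injectiveʳ (V.∷-injectiveˡ eq)) (shift-injective (V.∷-injectiveʳ eq)))
... | refl = refl
decL-injective (○ t) (● t′) eq = ⊥-elim (shift≢true∷ (dec t) (V.∷-injectiveʳ eq))
decL-injective (● t) (○ t′) eq = ⊥-elim (shift≢true∷ (dec t′) (sym (V.∷-injectiveʳ eq)))
decL-injective (● t) (◐ t′) eq = ⊥-elim (shift≢true∷ (dec t′) (sym (V.∷-injectiveʳ eq)))
decL-injective (◐ t) (● t′) eq = ⊥-elim (shift≢true∷ (dec t) (V.∷-injectiveʳ eq))
decL-injective (○ t) (◐ t′) eq with V.∷-injectiveˡ (V.∷-injectiveˡ eq)
... | ()
decL-injective (◐ t) (○ t′) eq with V.∷-injectiveˡ (V.∷-injectiveˡ eq)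
... | ()

dec-injective : {t t′ : Code false n k} → dec t ≡ dec t′ → t ≡ t′
dec-injective {t = t} {t′} eq
  with decL-injective t t′ (trans (decL-false t) (trans (cong (_ ∷_) eq) (sym (decL-false t′))))
... | refl = refl

zeros : ∀ n → Code false n 0
zeros zero    = ε
zeros (suc n) = ○ zeros n

-- The word ●ᵏ○ⁿ⁻ᵏ, which encodes `u`.
highest : k ≤ n → Code false n k
highest (z≤n {n}) = zeros n
highest (s≤s h)   = ● highest h

zeros-unique : (t : Code false n 0) → t ≡ zeros n
zeros-unique ε     = refl
zeros-unique (○ t) = cong ○_ (zeros-unique t)

tabulate-false : ∀ n → V.tabulate {n = n} (λ _ → false) ≡ emptyBox n
tabulate-false zero    = refl
tabulate-false (suc n) = cong (false ∷_) (tabulate-false n)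

u-suc : ∀ n k → u {suc n} {suc k} ≡ (true ∷ emptyBox n) ∷ shift (u {n} {k})
u-suc n k = cong₂ _∷_ (cong (true ∷_) (tabulate-false n)) (V.tabulate-∘ (false ∷_) _)

dec-highest : (h : k ≤ n) → dec (highest h) ≡ u
dec-highest (z≤n {n}) with dec (zeros n)
... | [] = refl
dec-highest {suc k} {suc n} (s≤s h) = trans
  (cong₂ _∷_ (cong (true ∷_) (lead-empty (highest h))) (cong shift (dec-highest h)))
  (sym (u-suc n k))

eqBox-sound : (A B : Box n) → eqBox A B ≡ true → A ≡ B
eqBox-sound []          []          _  = refl
eqBox-sound (true ∷ A)  (true ∷ B)  eq = cong (true ∷_) (eqBox-sound A B eq)
eqBox-sound (false ∷ A) (false ∷ B) eq = cong (false ∷_) (eqBox-sound A B eq)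

eqBox-refl : (A : Box n) → eqBox A A ≡ true
eqBox-refl []          = refl
eqBox-refl (true ∷ A)  = eqBox-refl A
eqBox-refl (false ∷ A) = eqBox-refl A

eqTab-sound : (S T : Tab n k) → eqTab S T ≡ true → S ≡ T
eqTab-sound []      []      _  = refl
eqTab-sound (A ∷ S) (B ∷ T) eq =
  cong₂ _∷_ (eqBox-sound A B (∧-conicalˡ _ _ eq)) (eqTab-sound S T (∧-conicalʳ (eqBox A B) _ eq))

eqTab-refl : (T : Tab n k) → eqTab T T ≡ true
eqTab-refl []      = refl
eqTab-refl (A ∷ T) = cong₂ _∧_ (eqBox-refl A) (eqTab-refl T)

-- Highest weight elements and connectedness

-- One application of some eᵢ (left summand) or eᵢᴷ (right summand), for words with arbitrary `q`.
Red : Code q n k → Code q n k → Set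
Red {n = n} t t′ = ∃ λ (p : Pos n) → (∃ λ c → Fiber p t′ t c) ⊎ (∃ λ b → Fiber p t′ b t)

red-○ : {t t′ : Code q n k} → Red t t′ → Red (○ t) (○ t′)
red-○ (p , inj₁ (c , x)) = there p , inj₁ (○ c , there○ x)
red-○ (p , inj₂ (b , x)) = there p , inj₂ (○ b , there○ x)

red-● : {t t′ : Code q n k} → Red t t′ → Red (● t) (● t′)
red-● (p , inj₁ (c , x)) = there p , inj₁ (● c , there● x)
red-● (p , inj₂ (b , x)) = there p , inj₂ (● b , there● x)

red-◐ : {t t′ : Code q n k} → Red t t′ → Red (◐ t) (◐ t′)
red-◐ (p , inj₁ (c , x)) = there p , inj₁ (◐ c , there◐ x)
red-◐ (p , inj₂ (b , x)) = there p , inj₂ (◐ b , there◐ x)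

-- The ends of the leftward reduction. For `q` = true a single ◐ stays in front, since its box
-- starts outside the word.
data Normal : Code q n k → Set where
  nf  : (h : k ≤ n) → Normal (highest h)
  nf◐ : (h : k ≤ n) → Normal (◐ highest h)

-- Replacing ○● by ●○ repeatedly carries the first ○ past all the ●s.
bubble : (h : k ≤ n) → ∃ λ h′ → Star Red (○ highest h) (highest h′)
bubble z≤n     = z≤n , ε
bubble (s≤s h) with bubble h
... | h′ , r = s≤s h′ , (here , inj₁ (_ , here● (highest h))) ◅ Star.gmap ●_ red-● r

-- The rest of the word is normalised first. If it then starts with ◐, one step removes that ◐
-- (after ● or ◐) or moves it to the front (after ○); the ○ left behind is carried to the right by
-- `bubble`.
normalise : (t : Code q n k) → ∃ λ t′ → Normal t′ × Star Red t t′
normalise ε = ε , nf z≤n , ε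
normalise (○ t) with normalise t
... | _ , nf h , r with bubble h
...   | h′ , r′ = _ , nf h′ , Star.gmap ○_ red-○ r ◅◅ r′
normalise (○ t) | _ , nf◐ h , r with bubble h
...   | h′ , r′ = _ , nf◐ h′ , Star.gmap ○_ red-○ r ◅◅
        (here , inj₁ (_ , here◐ (highest h))) ◅ Star.gmap ◐_ red-◐ r′
normalise (● t) with normalise t
... | _ , nf h , r = _ , nf (s≤s h) , Star.gmap ●_ red-● r
... | _ , nf◐ h , r with bubble h
...   | h′ , r′ = _ , nf (s≤s h′) , Star.gmap ●_ red-● r ◅◅
        (here , inj₂ (_ , here● (highest h))) ◅ Star.gmap ●_ red-● r′
normalise (◐ t) with normalise t
... | _ , nf h , r = _ , nf◐ h , Star.gmap ◐_ red-◐ r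
... | _ , nf◐ h , r with bubble h
...   | h′ , r′ = _ , nf◐ h′ , Star.gmap ◐_ red-◐ r ◅◅
        (here , inj₂ (_ , here◐ (highest h))) ◅ Star.gmap ◐_ red-◐ r′

reduces-to-highest : (h : k ≤ n) (t : Code false n k) → Star Red t (highest h)
reduces-to-highest h t with normalise t
-- `nf◐` is impossible for `q` = false, and the two proofs of k ≤ n are equal.
... | _ , nf h′ , r = subst (λ h → Star Red t (highest h)) (ℕ.≤-irrelevant h′ h) r

red-edge : {t t′ : Code false n k} → Red t t′ → Edge n k (dec t′) (dec t)
red-edge (p , inj₁ (_ , x)) = pos p , (s≤s z≤n , pos<n p) , inj₁ (f-top x)
red-edge (p , inj₂ (_ , x)) = pos p , (s≤s z≤n , pos<n p) , inj₂ (fK-top x)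

connected-to-u : k ≤ n → (T : Tab n k) → Valid T → EqClosure (Edge n k) T u
connected-to-u h T v with dec-surjective T v
... | t , refl = subst (EqClosure _ (dec t)) (dec-highest h)
                   (Star.gmap dec (λ r → bwd (red-edge r)) (reduces-to-highest h t))

-- Adjacent letters of ●ᵏ○ⁿ⁻ᵏ are ●●, ●○ or ○○, so this word is never one of the lower words of a
-- fiber.
highest-view : (p : Pos n) (h : k ≤ n) →
               Single p (highest h) ⊎ ∃ λ b → ∃ λ c → Fiber p (highest h) b c
highest-view here z≤n = inj₁ (here○○ _)
highest-view here (s≤s z≤n) = inj₂ (_ , _ , here● _)
highest-view here (s≤s (s≤s h)) = inj₁ (here●● _)
highest-view (there p) z≤n with highest-view p z≤n
... | inj₁ s = inj₁ (there○ s)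
... | inj₂ (_ , _ , x) = inj₂ (_ , _ , there○ x)
highest-view (there p) (s≤s h) with highest-view p h
... | inj₁ s = inj₁ (there● s)
... | inj₂ (_ , _ , x) = inj₂ (_ , _ , there● x)

u-highest-weight : k ≤ n → ∀ i → 1 ≤ i → i < n → e i (u {n} {k}) ≡ nothing × eK i (u {n} {k}) ≡ nothing
u-highest-weight h i 1≤i i<n rewrite sym (dec-highest h) with position 1≤i i<n
... | p , refl with highest-view p h
...   | inj₁ s = e-eK-single s
...   | inj₂ (_ , _ , x) = e-top x , eK-top x

-- If the reduction to `u` had a first step, that step would be an applicable eᵢ or eᵢᴷ.
highest-weight-unique : k ≤ n → (T : Tab n k) → Valid T →
  (∀ i → 1 ≤ i → i < n → e i T ≡ nothing × eK i T ≡ nothing) → T ≡ u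
highest-weight-unique h T v hw with dec-surjective T v
... | t , refl with reduces-to-highest h t
...   | ε = dec-highest h
...   | (p , inj₁ (_ , x)) ◅ _ =
        contradiction (trans (sym (e-mid x)) (proj₁ (hw (pos p) (s≤s z≤n) (pos<n p)))) λ ()
...   | (p , inj₂ (_ , x)) ◅ _ =
        contradiction (trans (sym (eK-bot x)) (proj₂ (hw (pos p) (s≤s z≤n) (pos<n p)))) λ ()

k1 : k ≤ n → K1 n k
k1 h = (λ T T′ v v′ → connected-to-u h T v ◅◅ Eq.symmetric _ (connected-to-u h T′ v′))
     , subst Valid (dec-highest h) (dec-valid (highest h))
     , u-highest-weight h
     , highest-weight-unique h

-- Box maxima and the dominance order

-- An entry is the maximum of its box iff the next letter other than ○ is not ◐, which is what `q`
-- of the remaining word records.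
maxima : Code q n k → Vec Bool n
maxima ε             = []
maxima (○ t)         = false ∷ maxima t
maxima (●_ {q} t)    = not q ∷ maxima t
maxima (◐_ {q} t)    = not q ∷ maxima t

raise : Pos n → Vec Bool n → Vec Bool n
raise here      (a ∷ b ∷ K) = (a ∨ b) ∷ (a ∧ b) ∷ K
raise (there p) (a ∷ K)     = a ∷ raise p K

raise-top : {p : Pos n} {a b c : Code q n k} → Fiber p a b c → raise p (maxima a) ≡ maxima a
raise-top (here● {false} t) = refl
raise-top (here● {true} t)  = refl
raise-top (here◐ {false} t) = refl
raise-top (here◐ {true} t)  = refl
raise-top (there○ x) = cong (_ ∷_) (raise-top x)
raise-top (there● x) = cong (_ ∷_) (raise-top x)
raise-top (there◐ x) = cong (_ ∷_) (raise-top x)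

raise-mid : {p : Pos n} {a b c : Code q n k} → Fiber p a b c → raise p (maxima b) ≡ maxima a
raise-mid (here● t)  = refl
raise-mid (here◐ t)  = refl
raise-mid (there○ x) = cong (_ ∷_) (raise-mid x)
raise-mid (there● x) = cong (_ ∷_) (raise-mid x)
raise-mid (there◐ x) = cong (_ ∷_) (raise-mid x)

-- The two words differ only by the entry i in the box that contains i+1, and i is not the maximum
-- there.
maxima-mid-bot : {p : Pos n} {a b c : Code q n k} → Fiber p a b c → maxima b ≡ maxima c
maxima-mid-bot (here● t)  = refl
maxima-mid-bot (here◐ t)  = refl
maxima-mid-bot (there○ x) = cong (_ ∷_) (maxima-mid-bot x)
maxima-mid-bot (there● x) = cong (_ ∷_) (maxima-mid-bot x)
maxima-mid-bot (there◐ x) = cong (_ ∷_) (maxima-mid-bot x)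

raise-single : {p : Pos n} {a : Code q n k} → Single p a → raise p (maxima a) ≡ maxima a
raise-single (here○○ t) = refl
raise-single (here●● t) = refl
raise-single (here◐● t) = refl
raise-single (there○ s) = cong (_ ∷_) (raise-single s)
raise-single (there● s) = cong (_ ∷_) (raise-single s)
raise-single (there◐ s) = cong (_ ∷_) (raise-single s)

lower-dec : (p : Pos n) (t : Code false n k) →
            ∃ λ t′ → lower (pos p) (dec t) ≡ dec t′ × maxima t′ ≡ raise p (maxima t)
lower-dec p t with view p t
... | single s = t , lower-single s , sym (raise-single s)
... | top x = t , lower-top x , sym (raise-top x)
... | mid x = _ , lower-mid x , sym (raise-mid x)
... | bot {b = b} x = _ , lower-bot x , sym (trans (cong (raise p) (sym (maxima-mid-bot x))) (raise-mid x))

-- Dom d S K: for all j, the first j positions of K together with d extra elements contain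
-- at least as many elements as the first j positions of S, with equality for j = n.
data Dom : ℕ → Vec Bool n → Vec Bool n → Set where
  []   : Dom 0 [] []
  none : ∀ {d} {S K : Vec Bool n} → Dom d S K → Dom d (false ∷ S) (false ∷ K)
  both : ∀ {d} {S K : Vec Bool n} → Dom d S K → Dom d (true ∷ S) (true ∷ K)
  gain : ∀ {d} {S K : Vec Bool n} → Dom (suc d) S K → Dom d (false ∷ S) (true ∷ K)
  loss : ∀ {d} {S K : Vec Bool n} → Dom d S K → Dom (suc d) (true ∷ S) (false ∷ K)

swapAt : ∀ {A : Set} → Pos n → Vec A n → Vec A n
swapAt here      (a ∷ b ∷ v) = b ∷ a ∷ v
swapAt (there p) (a ∷ v)     = a ∷ swapAt p v

-- Allows i+1 in the set only together with i. For the set w{1,...,k} this is what sᵢw > w provides.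
Ascent : Pos n → Vec Bool n → Set
Ascent here      (a ∷ b ∷ S) = ¬ (a ≡ false × b ≡ true)
Ascent (there p) (a ∷ S)     = Ascent p S

-- With `dom-swap` this is the lifting property of the Bruhat order, for subsets: K ≤ sᵢS iff the
-- sorted K is ≤ S. Only the count over the first i positions changes, so it suffices to inspect the
-- entries at i and i+1.
dom-raise : ∀ {d} (p : Pos n) (S K : Vec Bool n) → Ascent p S →
            Dom d (swapAt p S) K → Dom d S (raise p K)
dom-raise here (false ∷ true ∷ S) K asc D = ⊥-elim (asc (refl , refl))
dom-raise here (false ∷ false ∷ S) (false ∷ false ∷ K) _ (none (none D)) = none (none D)
dom-raise here (false ∷ false ∷ S) (false ∷ true ∷ K)  _ (none (gain D)) = gain (none D)
dom-raise here (false ∷ false ∷ S) (true ∷ false ∷ K)  _ (gain (none D)) = gain (none D)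
dom-raise here (false ∷ false ∷ S) (true ∷ true ∷ K)   _ (gain (gain D)) = gain (gain D)
dom-raise here (true ∷ true ∷ S)   (false ∷ false ∷ K) _ (loss (loss D)) = loss (loss D)
dom-raise here (true ∷ true ∷ S)   (false ∷ true ∷ K)  _ (loss (both D)) = both (loss D)
dom-raise here (true ∷ true ∷ S)   (true ∷ false ∷ K)  _ (both (loss D)) = both (loss D)
dom-raise here (true ∷ true ∷ S)   (true ∷ true ∷ K)   _ (both (both D)) = both (both D)
dom-raise here (true ∷ false ∷ S)  (false ∷ false ∷ K) _ (none (loss D)) = loss (none D)
dom-raise here (true ∷ false ∷ S)  (false ∷ true ∷ K)  _ (none (both D)) = both (none D)
dom-raise here (true ∷ false ∷ S)  (true ∷ false ∷ K)  _ (gain (loss D)) = both (none D)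
dom-raise here (true ∷ false ∷ S)  (true ∷ true ∷ K)   _ (gain (both D)) = both (gain D)
dom-raise (there p) (_ ∷ S) (_ ∷ K) asc (none D) = none (dom-raise p S K asc D)
dom-raise (there p) (_ ∷ S) (_ ∷ K) asc (both D) = both (dom-raise p S K asc D)
dom-raise (there p) (_ ∷ S) (_ ∷ K) asc (gain D) = gain (dom-raise p S K asc D)
dom-raise (there p) (_ ∷ S) (_ ∷ K) asc (loss D) = loss (dom-raise p S K asc D)

dom-swap : ∀ {d} (p : Pos n) (S K : Vec Bool n) → Ascent p S →
           Dom d S (raise p K) → Dom d (swapAt p S) K
dom-swap here (false ∷ true ∷ S) K asc D = ⊥-elim (asc (refl , refl))
dom-swap here (false ∷ false ∷ S) (false ∷ false ∷ K) _ (none (none D)) = none (none D)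
dom-swap here (false ∷ false ∷ S) (false ∷ true ∷ K)  _ (gain (none D)) = none (gain D)
dom-swap here (false ∷ false ∷ S) (true ∷ false ∷ K)  _ (gain (none D)) = gain (none D)
dom-swap here (false ∷ false ∷ S) (true ∷ true ∷ K)   _ (gain (gain D)) = gain (gain D)
dom-swap here (true ∷ true ∷ S)   (false ∷ false ∷ K) _ (loss (loss D)) = loss (loss D)
dom-swap here (true ∷ true ∷ S)   (false ∷ true ∷ K)  _ (both (loss D)) = loss (both D)
dom-swap here (true ∷ true ∷ S)   (true ∷ false ∷ K)  _ (both (loss D)) = both (loss D)
dom-swap here (true ∷ true ∷ S)   (true ∷ true ∷ K)   _ (both (both D)) = both (both D)
dom-swap here (true ∷ false ∷ S)  (false ∷ false ∷ K) _ (loss (none D)) = none (loss D)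
dom-swap here (true ∷ false ∷ S)  (false ∷ true ∷ K)  _ (both (none D)) = none (both D)
dom-swap here (true ∷ false ∷ S)  (true ∷ false ∷ K)  _ (both (none D)) = gain (loss D)
dom-swap here (true ∷ false ∷ S)  (true ∷ true ∷ K)   _ (both (gain D)) = gain (both D)
dom-swap (there p) (_ ∷ S) (_ ∷ K) asc (none D) = none (dom-swap p S K asc D)
dom-swap (there p) (_ ∷ S) (_ ∷ K) asc (both D) = both (dom-swap p S K asc D)
dom-swap (there p) (_ ∷ S) (_ ∷ K) asc (gain D) = gain (dom-swap p S K asc D)
dom-swap (there p) (_ ∷ S) (_ ∷ K) asc (loss D) = loss (dom-swap p S K asc D)

dom-refl : (S : Vec Bool n) → Dom 0 S S
dom-refl []          = []
dom-refl (false ∷ S) = none (dom-refl S)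
dom-refl (true ∷ S)  = both (dom-refl S)

-- Dominance forces each of the first k letters to be the maximum of a box. So these letters are all
-- ●, no ◐ follows, and only ○ is left.
dom-highest : (h : k ≤ n) (t : Code false n k) → Dom 0 (maxima (highest h)) (maxima t) → t ≡ highest h
dom-highest z≤n     t D = zeros-unique t
dom-highest (s≤s h) (○ t) ()
dom-highest (s≤s h) (●_ {false} t) (both D) = cong ●_ (dom-highest h t D)
dom-highest (s≤s h) (●_ {true} t) ()

-- Reduced words

≡ᵇ-refl : ∀ i → (i ≡ᵇ i) ≡ true
≡ᵇ-refl zero    = refl
≡ᵇ-refl (suc i) = ≡ᵇ-refl i

≢⇒≡ᵇ : ∀ {i j} → ¬ i ≡ j → (i ≡ᵇ j) ≡ false
≢⇒≡ᵇ {i} {j} i≢j with i ≡ᵇ j in eq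
... | false = refl
... | true  = contradiction (ℕ.≡ᵇ⇒≡ i j (subst T (sym eq) _)) i≢j

data SAct (i : ℕ) : ℕ → ℕ → Set where
  up   : SAct i i (suc i)
  down : SAct i (suc i) i
  fix  : ∀ {j} → ¬ j ≡ i → ¬ j ≡ suc i → SAct i j j

sAct-up : ∀ i → sAct i i ≡ suc i
sAct-up i rewrite ≡ᵇ-refl i = refl

sAct-down : ∀ i → sAct i (suc i) ≡ i
sAct-down i rewrite ≢⇒≡ᵇ {suc i} {i} (λ ()) | ≡ᵇ-refl i = refl

sAct-fix : ∀ {i j} → ¬ j ≡ i → ¬ j ≡ suc i → sAct i j ≡ j
sAct-fix j≢i j≢1+i rewrite ≢⇒≡ᵇ j≢i | ≢⇒≡ᵇ j≢1+i = refl

sAct-view : ∀ i j → SAct i j (sAct i j)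
sAct-view i j with j ≟ i | j ≟ suc i
... | yes refl | _        rewrite sAct-up i = up
... | no _     | yes refl rewrite sAct-down i = down
... | no j≢i   | no j≢1+i rewrite sAct-fix j≢i j≢1+i = fix j≢i j≢1+i

sAct-involutive : ∀ i j → sAct i (sAct i j) ≡ j
sAct-involutive i j with sAct i j | sAct-view i j
... | _ | up              = sAct-down i
... | _ | down            = sAct-up i
... | _ | fix j≢i j≢1+i   = sAct-fix j≢i j≢1+i

sAct-suc : ∀ i j → sAct (suc i) (suc j) ≡ suc (sAct i j)
sAct-suc i j with j ≡ᵇ i | j ≡ᵇ suc i
... | true  | _     = refl
... | false | true  = refl
... | false | false = refl

sAct-range : ∀ {n i j} → 1 ≤ i × i < n → 1 ≤ j × j ≤ n → 1 ≤ sAct i j × sAct i j ≤ n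
sAct-range {i = i} {j} (1≤i , i<n) (1≤j , j≤n) with sAct i j | sAct-view i j
... | _ | up       = s≤s z≤n , i<n
... | _ | down     = 1≤i , ℕ.<⇒≤ i<n
... | _ | fix _ _  = 1≤j , j≤n

sAct-descent : ∀ {i j l} → j < l → sAct i l < sAct i j → j ≡ i × l ≡ suc i
sAct-descent {i} {j} {l} j<l lt with sAct i j | sAct-view i j | sAct i l | sAct-view i l
... | _ | up         | _ | up      = contradiction j<l (ℕ.<-irrefl refl)
... | _ | up         | _ | down    = refl , refl
... | _ | up         | _ | fix _ _ = contradiction (ℕ.<-≤-trans lt j<l) (ℕ.<-irrefl refl)
... | _ | down       | _ | up      = contradiction j<l (ℕ.<-asym (ℕ.n<1+n i))
... | _ | down       | _ | down    = contradiction j<l (ℕ.<-irrefl refl)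
... | _ | down       | _ | fix _ _ = contradiction (ℕ.<-trans lt (ℕ.<-trans (ℕ.n<1+n i) j<l)) (ℕ.<-irrefl refl)
... | _ | fix _ _    | _ | up      = contradiction (ℕ.<-trans (ℕ.<-trans j<l (ℕ.n<1+n i)) lt) (ℕ.<-irrefl refl)
... | _ | fix j≢ _   | _ | down    = contradiction (ℕ.≤-antisym (ℕ.≤-pred j<l) (ℕ.<⇒≤ lt)) j≢
... | _ | fix _ _    | _ | fix _ _ = contradiction j<l (ℕ.<-asym lt)

invWord : List ℕ → ℕ → ℕ
invWord []      j = j
invWord (i ∷ w) j = invWord w (sAct i j)

eval-inv : ∀ w j → evalWord w (invWord w j) ≡ j
eval-inv []      j = refl
eval-inv (i ∷ w) j = trans (cong (sAct i) (eval-inv w (sAct i j))) (sAct-involutive i j)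

inv-eval : ∀ w j → invWord w (evalWord w j) ≡ j
inv-eval []      j = refl
inv-eval (i ∷ w) j = trans (cong (invWord w) (sAct-involutive i (evalWord w j))) (inv-eval w j)

eval-injective : ∀ w {x y} → evalWord w x ≡ evalWord w y → x ≡ y
eval-injective w {x} {y} eq = trans (sym (inv-eval w x)) (trans (cong (invWord w) eq) (inv-eval w y))

inv-range : ∀ {n w j} → GoodWord n w → 1 ≤ j × j ≤ n → 1 ≤ invWord w j × invWord w j ≤ n
inv-range []       r = r
inv-range (g ∷ gs) r = inv-range gs (sAct-range g r)

inv-cong : ∀ {n v w} → GoodWord n w → SamePerm n v w → ∀ j → 1 ≤ j × j ≤ n → invWord v j ≡ invWord w j
inv-cong {v = v} {w} gw same j r = let 1≤x , x≤n = inv-range gw r in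
  trans (cong (invWord v) (sym (trans (same _ 1≤x x≤n) (eval-inv w j)))) (inv-eval v (invWord w j))

record Swapped (a b : ℕ) (v w : List ℕ) : Set where
  field
    at-a  : evalWord v a ≡ evalWord w b
    at-b  : evalWord v b ≡ evalWord w a
    other : ∀ x → ¬ x ≡ a → ¬ x ≡ b → evalWord v x ≡ evalWord w x

-- Strong exchange: reading w from the right, the letter at which the values of a and b
-- first change their order can be deleted.
delete-letter : ∀ {n a b} w → GoodWord n w → a < b → evalWord w b < evalWord w a →
                ∃ λ v → GoodWord n v × suc (length v) ≡ length w × Swapped a b v w
delete-letter [] [] a<b b<a = contradiction a<b (ℕ.<-asym b<a)
delete-letter {a = a} {b} (i ∷ w) (g ∷ gs) a<b lt with ℕ.<-cmp (evalWord w a) (evalWord w b)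
... | tri> _ _ wb<wa with delete-letter w gs a<b wb<wa
...   | v , gv , len , sw = i ∷ v , g ∷ gv , cong suc len , record
        { at-a  = cong (sAct i) (Swapped.at-a sw)
        ; at-b  = cong (sAct i) (Swapped.at-b sw)
        ; other = λ x x≢a x≢b → cong (sAct i) (Swapped.other sw x x≢a x≢b) }
delete-letter {a = a} {b} (i ∷ w) (g ∷ gs) a<b lt | tri≈ _ wa≡wb _ =
  contradiction (eval-injective w wa≡wb) (ℕ.<⇒≢ a<b)
delete-letter {a = a} {b} (i ∷ w) (g ∷ gs) a<b lt | tri< wa<wb _ _
  with sAct-descent {i} wa<wb lt
... | wa≡i , wb≡1+i = w , gs , refl , record
        { at-a  = trans wa≡i (sym (trans (cong (sAct i) wb≡1+i) (sAct-down i)))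
        ; at-b  = trans wb≡1+i (sym (trans (cong (sAct i) wa≡i) (sAct-up i)))
        ; other = λ x x≢a x≢b → sym (sAct-fix
            (λ eq → x≢a (eval-injective w (trans eq (sym wa≡i))))
            (λ eq → x≢b (eval-injective w (trans eq (sym wb≡1+i))))) }

reduced-tail : ∀ {n i w} → Reduced n (i ∷ w) → Reduced n w
reduced-tail {i = i} {w} (g ∷ gs , min) = gs , λ v gv same →
  ℕ.≤-pred (min (i ∷ v) (g ∷ gv) (λ j 1≤j j≤n → cong (sAct i) (same j 1≤j j≤n)))

-- Otherwise strong exchange, applied to the positions `a` and `b` of i+1 and i, deletes a letter of
-- w and yields a word for sᵢw shorter than w, against the minimality of `i ∷ w`.
reduced-ascent : ∀ {n i w} → Reduced n (i ∷ w) → ¬ invWord w (suc i) < invWord w i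
reduced-ascent {n} {i} {w} (g ∷ gs , min) lt with delete-letter w gs lt
    (subst₂ _<_ (sym (eval-inv w i)) (sym (eval-inv w (suc i))) (ℕ.n<1+n i))
... | v , gv , len , sw = contradiction (min v gv λ x _ _ → same x)
      (ℕ.<⇒≱ (ℕ.≤-trans (ℕ.≤-reflexive len) (ℕ.n≤1+n (length w))))
  where
    a b : ℕ
    a = invWord w (suc i)
    b = invWord w i
    same : ∀ x → evalWord v x ≡ sAct i (evalWord w x)
    same x with x ≟ a | x ≟ b
    ... | yes refl | _ rewrite Swapped.at-a sw | eval-inv w i | eval-inv w (suc i) = sym (sAct-down i)
    ... | no _ | yes refl rewrite Swapped.at-b sw | eval-inv w i | eval-inv w (suc i) = sym (sAct-up i)
    ... | no x≢a | no x≢b = trans (Swapped.other sw x x≢a x≢b) (sym (sAct-fix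
            (λ eq → x≢b (eval-injective w (trans eq (sym (eval-inv w i)))))
            (λ eq → x≢a (eval-injective w (trans eq (sym (eval-inv w (suc i))))))))

-- The set w{1,...,k} and membership in the Demazure crystal

tabulate₁ : ∀ {A : Set} n → (ℕ → A) → Vec A n
tabulate₁ n F = V.tabulate (λ j → F (suc (toℕ j)))

tabulate₁-sAct : ∀ {A : Set} (p : Pos n) (F : ℕ → A) →
                 tabulate₁ n (λ j → F (sAct (pos p) j)) ≡ swapAt p (tabulate₁ n F)
tabulate₁-sAct here      F = refl
tabulate₁-sAct (there p) F = cong (F 1 ∷_) (trans
  (V.tabulate-cong (λ j → cong F (sAct-suc (pos p) (suc (toℕ j)))))
  (tabulate₁-sAct p (F ∘ suc)))

tabulate₁-cong : ∀ {A : Set} n {F G : ℕ → A} → (∀ j → 1 ≤ j × j ≤ n → F j ≡ G j) →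
                 tabulate₁ n F ≡ tabulate₁ n G
tabulate₁-cong zero    h = refl
tabulate₁-cong (suc n) h = cong₂ _∷_ (h 1 (s≤s z≤n , s≤s z≤n))
  (tabulate₁-cong n λ j (1≤j , j≤n) → h (suc j) (s≤s z≤n , s≤s j≤n))

tabulate₁-ascent : (p : Pos n) (F : ℕ → Bool) → ¬ (F (pos p) ≡ false × F (suc (pos p)) ≡ true) →
                   Ascent p (tabulate₁ n F)
tabulate₁-ascent here      F asc = asc
tabulate₁-ascent (there p) F asc = tabulate₁-ascent p (F ∘ suc) asc

-- The set w{1,…,k}.
image : ∀ n k → List ℕ → Vec Bool n
image n k w = tabulate₁ n (λ j → invWord w j ≤ᵇ k)

image-cong : ∀ v w k → GoodWord n w → SamePerm n v w → image n k v ≡ image n k w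
image-cong v w k gw same = tabulate₁-cong _ {λ j → invWord v j ≤ᵇ k}
  λ j r → cong (_≤ᵇ k) (inv-cong {v = v} gw same j r)

-- If i+1 were in w{1,...,k} and i were not, then w⁻¹(i+1) ≤ k < w⁻¹(i), contrary to
-- `reduced-ascent`.
image-ascent : ∀ k (p : Pos n) {w} → Reduced n (pos p ∷ w) → Ascent p (image n k w)
image-ascent k p {w} red = tabulate₁-ascent p (λ j → invWord w j ≤ᵇ k) λ (b≰k , a≤k) → reduced-ascent red
  (ℕ.≤-<-trans (ℕ.≤ᵇ⇒≤ _ _ (subst T (sym a≤k) _)) (ℕ.≰⇒> λ b≤k → subst T b≰k (ℕ.≤⇒≤ᵇ b≤k)))

tabulate₁-const : ∀ {A : Set} n (x : A) → tabulate₁ n (λ _ → x) ≡ V.replicate n x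
tabulate₁-const zero    x = refl
tabulate₁-const (suc n) x = cong (x ∷_) (tabulate₁-const n x)

maxima-zeros : ∀ n → maxima (zeros n) ≡ V.replicate n false
maxima-zeros zero    = refl
maxima-zeros (suc n) = cong (false ∷_) (maxima-zeros n)

maxima-highest : (h : k ≤ n) → maxima (highest h) ≡ tabulate₁ n (_≤ᵇ k)
maxima-highest (z≤n {n}) = trans (maxima-zeros n) (sym (tabulate₁-const n false))
maxima-highest {suc k} {suc n} (s≤s h) = cong (true ∷_) (maxima-highest h)

-- The head of the word is the operator applied first, so the induction passes from `t` to its
-- lowered word `t′`. On maxima this is `raise`, on images the head acts by `swapAt`, and the
-- lifting property matches the two.
demazure-dom : ∀ {w} → k ≤ n → Reduced n w → (t : Code false n k) →
               inDemB w (dec t) ≡ true ⇔ Dom 0 (image n k w) (maxima t)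
demazure-dom {k} {n} {[]} h red t = mk⇔ to from
  where
    to : inDemB [] (dec t) ≡ true → Dom 0 (image n k []) (maxima t)
    to eq with dec-injective {t = t} {highest h}
                 (trans (eqTab-sound (dec t) u eq) (sym (dec-highest h)))
    ... | refl = subst (λ S → Dom 0 S (maxima t)) (maxima-highest h) (dom-refl (maxima t))
    from : Dom 0 (image n k []) (maxima t) → inDemB [] (dec t) ≡ true
    from D with dom-highest h t (subst (λ S → Dom 0 S (maxima t)) (sym (maxima-highest h)) D)
    ... | refl = trans (cong (λ T → eqTab T u) (dec-highest h)) (eqTab-refl {n} {k} u)
demazure-dom {k} {n} {i ∷ w} h red@((1≤i , i<n) ∷ _ , _) t with position 1≤i i<n
... | p , refl with lower-dec p t
...   | t′ , eq , max = mk⇔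
        (λ d → subst (λ S → Dom 0 S (maxima t)) (sym swap)
          (dom-swap p _ (maxima t) asc (subst (Dom 0 (image n k w)) max
            (to (trans (cong (inDemB w) (sym eq)) d)))))
        (λ D → trans (cong (inDemB w) eq) (from (subst (Dom 0 (image n k w)) (sym max)
          (dom-raise p _ (maxima t) asc (subst (λ S → Dom 0 S (maxima t)) swap D)))))
  where
    open Equivalence (demazure-dom {w = w} h (reduced-tail red) t′)
    asc : Ascent p (image n k w)
    asc = image-ascent k p red
    swap : image n k (pos p ∷ w) ≡ swapAt p (image n k w)
    swap = tabulate₁-sAct p (λ j → invWord w j ≤ᵇ k)

≡true-ext : ∀ {x y : Bool} → (x ≡ true → y ≡ true) → (y ≡ true → x ≡ true) → x ≡ y
≡true-ext {false} {false} _ _ = refl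
≡true-ext {false} {true}  _ g = g refl
≡true-ext {true}  {y}     h _ = sym (h refl)

-- Used with two words and one tableau for K.2, and with one word and the two lower elements of a
-- fiber for K.3.
demazure-cong : ∀ {v w} → k ≤ n → Reduced n v → Reduced n w → (s t : Code false n k) →
                image n k v ≡ image n k w → maxima s ≡ maxima t → inDemB v (dec s) ≡ inDemB w (dec t)
demazure-cong {v = v} {w} h rv rw s t eq max = ≡true-ext
  (λ d → from wt′ (subst₂ (Dom 0) eq max (to vs d)))
  (λ d → from vs (subst₂ (Dom 0) (sym eq) (sym max) (to wt′ d)))
  where
    open Equivalence
    vs  = demazure-dom h rv s
    wt′ = demazure-dom h rw t

k2 : k ≤ n → K2 n k
k2 {k} h v w rv rw same T valid with dec-surjective T valid
... | t , refl = demazure-cong h rv rw t t (image-cong v w k (proj₁ rw) same) refl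

-- Finite sums

module _ {A : Set} where

  ∑ : List A → (A → ℤ) → ℤ
  ∑ []       F = + 0
  ∑ (x ∷ xs) F = F x + ∑ xs F

  ∑-cong : ∀ xs {F G : A → ℤ} → (∀ x → F x ≡ G x) → ∑ xs F ≡ ∑ xs G
  ∑-cong []       h = refl
  ∑-cong (x ∷ xs) h = cong₂ _+_ (h x) (∑-cong xs h)

  ∑-0 : ∀ xs {F : A → ℤ} → (∀ x → F x ≡ + 0) → ∑ xs F ≡ + 0
  ∑-0 []       h = refl
  ∑-0 (x ∷ xs) h rewrite h x = trans (ℤ.+-identityˡ _) (∑-0 xs h)

  ∑-++ : ∀ xs ys {F : A → ℤ} → ∑ (xs ++ ys) F ≡ ∑ xs F + ∑ ys F
  ∑-++ []       ys = sym (ℤ.+-identityˡ _)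
  ∑-++ (x ∷ xs) ys {F} = trans (cong (_+_ (F x)) (∑-++ xs ys)) (sym (ℤ.+-assoc (F x) _ _))

  ∑-+ : ∀ xs (F G : A → ℤ) → ∑ xs (λ x → F x + G x) ≡ ∑ xs F + ∑ xs G
  ∑-+ []       F G = refl
  ∑-+ (x ∷ xs) F G rewrite ∑-+ xs F G = lemma (F x) (G x) (∑ xs F) (∑ xs G)
    where
      lemma : ∀ a b c d → a + b + (c + d) ≡ a + c + (b + d)
      lemma = solve-∀

  ∑-neg : ∀ xs (F : A → ℤ) → ∑ xs (λ x → - F x) ≡ - ∑ xs F
  ∑-neg []       F = refl
  ∑-neg (x ∷ xs) F rewrite ∑-neg xs F = sym (ℤ.neg-distrib-+ (F x) (∑ xs F))

  ∑-↭ : ∀ {xs ys} (F : A → ℤ) → xs ↭ ys → ∑ xs F ≡ ∑ ys F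
  ∑-↭ F Perm.refl         = refl
  ∑-↭ F (Perm.prep x r)   = cong (_+_ (F x)) (∑-↭ F r)
  ∑-↭ F (Perm.swap {xs} {ys} x y r) rewrite ∑-↭ F r = lemma (F x) (F y) (∑ ys F)
    where
      lemma : ∀ a b c → a + (b + c) ≡ b + (a + c)
      lemma = solve-∀
  ∑-↭ F (Perm.trans r s)  = trans (∑-↭ F r) (∑-↭ F s)

  ∑-filterᵇ : ∀ (b : A → Bool) xs (F : A → ℤ) →
              ∑ (filterᵇ b xs) F ≡ ∑ xs (λ x → if b x then F x else + 0)
  ∑-filterᵇ b []       F = refl
  ∑-filterᵇ b (x ∷ xs) F with b x
  ... | true  = cong (_+_ (F x)) (∑-filterᵇ b xs F)
  ... | false = trans (∑-filterᵇ b xs F) (sym (ℤ.+-identityˡ _))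

  ∑-single : ∀ {xs y} {F : A → ℤ} → Unique xs → y ∈ xs → (∀ x → ¬ x ≡ y → F x ≡ + 0) → ∑ xs F ≡ F y
  ∑-single {y ∷ xs} {y} {F} (y∉ ∷ _) (here refl) h = trans (cong (_+_ (F y)) (rest xs y∉)) (ℤ.+-identityʳ (F y))
    where
      rest : ∀ xs → All (λ x → ¬ y ≡ x) xs → ∑ xs F ≡ + 0
      rest []       []         = refl
      rest (x ∷ xs) (y≢x ∷ y∉) = cong₂ _+_ (h x (y≢x ∘ sym)) (rest xs y∉)
  ∑-single {x ∷ xs} {y} {F} (x∉ ∷ u) (there y∈) h =
    trans (cong₂ _+_ (h x (All.lookup x∉ y∈)) (∑-single u y∈ h)) (ℤ.+-identityˡ (F y))

  ∑-triple : ∀ xs (F G H : A → ℤ) → (∀ x → F x + G x + H x ≡ + 0) → ∑ xs F + ∑ xs G + ∑ xs H ≡ + 0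
  ∑-triple xs F G H h = trans (cong (_+ ∑ xs H) (sym (∑-+ xs F G)))
    (trans (sym (∑-+ xs (λ x → F x + G x) H)) (∑-0 xs h))

∑-map : ∀ {A B : Set} (g : A → B) xs (F : B → ℤ) → ∑ (L.map g xs) F ≡ ∑ xs (F ∘ g)
∑-map g []       F = refl
∑-map g (x ∷ xs) F = cong (_+_ (F (g x))) (∑-map g xs F)

-- Enumeration of codes

codes  : ∀ q n k → List (Code q n k)
-- The words beginning with ●. They are kept apart because they exist only for positive k.
starts : ∀ n k → List (Code false (suc n) k)

codes false zero    zero    = ε ∷ []
codes false zero    (suc k) = []
codes true  zero    k       = []
codes false (suc n) k       = L.map ○_ (codes false n k) ++ starts n k
codes true  (suc n) k       =
  L.map ○_ (codes true n k) ++ L.map ◐_ (codes false n k) ++ L.map ◐_ (codes true n k)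

starts n zero    = []
starts n (suc k) = L.map ●_ (codes false n k) ++ L.map ●_ (codes true n k)

codes-complete : (t : Code q n k) → t ∈ codes q n k
codes-complete ε = here refl
codes-complete (○_ {false} t) = ∈-++⁺ˡ (∈-map⁺ ○_ (codes-complete t))
codes-complete (○_ {true} t)  = ∈-++⁺ˡ (∈-map⁺ ○_ (codes-complete t))
codes-complete (●_ {false} {n} {k} t) =
  ∈-++⁺ʳ (L.map ○_ (codes false n (suc k))) (∈-++⁺ˡ (∈-map⁺ ●_ (codes-complete t)))
codes-complete (●_ {true} {n} {k} t)  =
  ∈-++⁺ʳ (L.map ○_ (codes false n (suc k)))
    (∈-++⁺ʳ (L.map ●_ (codes false n k)) (∈-map⁺ ●_ (codes-complete t)))
codes-complete (◐_ {false} {n} {k} t) =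
  ∈-++⁺ʳ (L.map ○_ (codes true n k)) (∈-++⁺ˡ (∈-map⁺ ◐_ (codes-complete t)))
codes-complete (◐_ {true} {n} {k} t)  =
  ∈-++⁺ʳ (L.map ○_ (codes true n k))
    (∈-++⁺ʳ (L.map ◐_ (codes false n k)) (∈-map⁺ ◐_ (codes-complete t)))

map-disjoint : ∀ {A B C : Set} {g : A → C} {h : B → C} xs ys →
               (∀ x y → ¬ g x ≡ h y) → Disjoint (L.map g xs) (L.map h ys)
map-disjoint {g = g} {h} xs ys ne (v∈ , v∈′) with ∈-map⁻ g v∈ | ∈-map⁻ h v∈′
... | x , _ , refl | y , _ , eq = ne x y eq

++-disjoint : ∀ {A : Set} {xs} (ys {zs} : List A) → Disjoint xs ys → Disjoint xs zs → Disjoint xs (ys ++ zs)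
++-disjoint ys d d′ (v∈ , v∈′) with ∈-++⁻ ys v∈′
... | inj₁ v∈ys = d (v∈ , v∈ys)
... | inj₂ v∈zs = d′ (v∈ , v∈zs)

codes-unique  : ∀ q n k → Unique (codes q n k)
starts-unique : ∀ n k → Unique (starts n k)
codes-unique false zero    zero    = [] ∷ []
codes-unique false zero    (suc k) = []
codes-unique true  zero    k       = []
codes-unique false (suc n) k       =
  Unique.++⁺ (Unique.map⁺ (λ { refl → refl }) (codes-unique false n k)) (starts-unique n k) (disj k)
  where
    disj : ∀ k → Disjoint (L.map ○_ (codes false n k)) (starts n k)
    disj zero    (_ , ())
    disj (suc k) = ++-disjoint (L.map ●_ (codes false n k))
      (map-disjoint (codes false n (suc k)) (codes false n k) λ _ _ ())
      (map-disjoint (codes false n (suc k)) (codes true n k) λ _ _ ())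
codes-unique true  (suc n) k       =
  Unique.++⁺ (Unique.map⁺ (λ { refl → refl }) (codes-unique true n k))
    (Unique.++⁺ (Unique.map⁺ (λ { refl → refl }) (codes-unique false n k))
                (Unique.map⁺ (λ { refl → refl }) (codes-unique true n k))
                (map-disjoint (codes false n k) (codes true n k) λ _ _ ()))
    (++-disjoint (L.map ◐_ (codes false n k))
      (map-disjoint (codes true n k) (codes false n k) λ _ _ ())
      (map-disjoint (codes true n k) (codes true n k) λ _ _ ()))
starts-unique n zero    = []
starts-unique n (suc k) =
  Unique.++⁺ (Unique.map⁺ (λ { refl → refl }) (codes-unique false n k))
             (Unique.map⁺ (λ { refl → refl }) (codes-unique true n k))
             (map-disjoint (codes false n k) (codes true n k) λ _ _ ())

∈-concatMap : ∀ {A B : Set} (g : A → List B) {xs x y} → x ∈ xs → y ∈ g x → y ∈ concatMap g xs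
∈-concatMap g x∈ y∈ = ∈-concatMap⁺ g (lose x∈ y∈)

unique-concatMap : ∀ {A B : Set} (g : A → List B) {xs} → Unique xs → (∀ x → Unique (g x)) →
                   (∀ {x x′ y} → y ∈ g x → y ∈ g x′ → x ≡ x′) → Unique (concatMap g xs)
unique-concatMap g []           _  _   = []
unique-concatMap g {x ∷ xs} (x∉ ∷ u) ug inj = Unique.++⁺ (ug x) (unique-concatMap g u ug inj) disj
  where
    disj : Disjoint (g x) (concatMap g xs)
    disj (y∈ , y∈′) with find (∈-concatMap⁻ g {xs = xs} y∈′)
    ... | x′ , x′∈ , y∈gx′ = All.lookup x∉ x′∈ (inj y∈ y∈gx′)

∈-allBoxes : (A : Box n) → A ∈ allBoxes n
∈-allBoxes []          = here refl
∈-allBoxes (true ∷ A)  = ∈-concatMap _ (∈-allBoxes A) (here refl)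
∈-allBoxes (false ∷ A) = ∈-concatMap _ (∈-allBoxes A) (there (here refl))

∈-allTabs : (T : Tab n k) → T ∈ allTabs n k
∈-allTabs []      = here refl
∈-allTabs (A ∷ T) = ∈-concatMap _ (∈-allTabs T) (∈-map⁺ _ (∈-allBoxes A))

unique-allBoxes : ∀ n → Unique (allBoxes n)
unique-allBoxes zero    = [] ∷ []
unique-allBoxes (suc n) = unique-concatMap _ (unique-allBoxes n)
  (λ A → ((λ ()) ∷ []) ∷ [] ∷ [])
  λ { (here refl) (here refl) → refl ; (there (here refl)) (there (here refl)) → refl
    ; (here refl) (there (here ())) ; (there (here refl)) (here ()) }

unique-allTabs : ∀ n k → Unique (allTabs n k)
unique-allTabs n zero    = [] ∷ []
unique-allTabs n (suc k) = unique-concatMap _ (unique-allTabs n k)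
  (λ T → Unique.map⁺ V.∷-injectiveˡ (unique-allBoxes n))
  same
  where
    same : ∀ {S S′ : Tab n k} {T} → T ∈ L.map (_∷ S) (allBoxes n) → T ∈ L.map (_∷ S′) (allBoxes n) → S ≡ S′
    same T∈ T∈′ with ∈-map⁻ _ T∈ | ∈-map⁻ _ T∈′
    ... | _ , _ , refl | _ , _ , refl = refl

-- Two duplicate-free lists with the same members are permutations of each other.
SVT-codes : ∀ n k → SVT n k ↭ L.map dec (codes false n k)
SVT-codes n k = ∼bag⇒↭ (unique∧set⇒bag
  (Unique.filter⁺ (T? ∘ validB) (unique-allTabs n k))
  (Unique.map⁺ dec-injective (codes-unique false n k))
  (mk⇔ to from))
  where
    to : ∀ {T} → T ∈ SVT n k → T ∈ L.map dec (codes false n k)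
    to {S} S∈ with dec-surjective S (Equivalence.to T-≡
                     (proj₂ (∈-filter⁻ (T? ∘ validB) {xs = allTabs n k} S∈)))
    ... | t , refl = ∈-map⁺ dec (codes-complete t)
    from : ∀ {T} → T ∈ L.map dec (codes false n k) → T ∈ SVT n k
    from S∈ with ∈-map⁻ dec S∈
    ... | t , _ , refl = ∈-filter⁺ (T? ∘ validB) (∈-allTabs (dec t)) (Equivalence.from T-≡ (dec-valid t))

-- Summation over fibers

∑-codes-false : ∀ n k (F : Code false (suc n) k → ℤ) →
  ∑ (codes false (suc n) k) F ≡ ∑ (codes false n k) (F ∘ ○_) + ∑ (starts n k) F
∑-codes-false n k F = trans (∑-++ (L.map ○_ (codes false n k)) (starts n k))
  (cong (_+ ∑ (starts n k) F) (∑-map ○_ (codes false n k) F))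

∑-codes-true : ∀ n k (F : Code true (suc n) k → ℤ) →
  ∑ (codes true (suc n) k) F ≡
  ∑ (codes true n k) (F ∘ ○_) + (∑ (codes false n k) (F ∘ ◐_) + ∑ (codes true n k) (F ∘ ◐_))
∑-codes-true n k F = trans (∑-++ (L.map ○_ (codes true n k)) _)
  (cong₂ _+_ (∑-map ○_ (codes true n k) F)
    (trans (∑-++ (L.map ◐_ (codes false n k)) _)
      (cong₂ _+_ (∑-map ◐_ (codes false n k) F) (∑-map ◐_ (codes true n k) F))))

∑-starts : ∀ n k (F : Code false (suc n) (suc k) → ℤ) →
  ∑ (starts n (suc k)) F ≡ ∑ (codes false n k) (F ∘ ●_) + ∑ (codes true n k) (F ∘ ●_)
∑-starts n k F = trans (∑-++ (L.map ●_ (codes false n k)) _)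
  (cong₂ _+_ (∑-map ●_ (codes false n k) F) (∑-map ●_ (codes true n k) F))

-- A predicate instead of a pattern: in `starts n k` the index k need not be a successor.
data Starts : Code q n k → Set where
  starts● : (t : Code q n k) → Starts (● t)

∑-starts-0 : ∀ n k (F : Code false (suc n) k → ℤ) → (∀ t → Starts t → F t ≡ + 0) → ∑ (starts n k) F ≡ + 0
∑-starts-0 n zero    F h = refl
∑-starts-0 n (suc k) F h = trans (∑-starts n k F)
  (cong₂ _+_ (∑-0 (codes false n k) (λ t → h (● t) (starts● t))) (∑-0 (codes true n k) (λ t → h (● t) (starts● t))))

-- Here x, y, z are the sums over top, middle and bottom words, unprimed if the word after the two
-- letters has `q` = false and primed if true; v and w are the sums over single words.
regroup : ∀ {x x′ y y′ z z′ v w} → v ≡ + 0 → w ≡ + 0 → x + y + z ≡ + 0 → x′ + y′ + z′ ≡ + 0 →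
          (v + (y + y′)) + ((x + w) + (x′ + (z + z′))) ≡ + 0
regroup {x} {x′} {y} {y′} {z} {z′} refl refl s s′ =
  trans (lemma x x′ y y′ z z′) (cong₂ _+_ s s′)
  where
    lemma : ∀ x x′ y y′ z z′ →
      (+ 0 + (y + y′)) + ((x + + 0) + (x′ + (z + z′))) ≡ (x + y + z) + (x′ + y′ + z′)
    lemma = solve-∀

-- The words split into fibers and single words. The recursion follows the enumeration of words down
-- to the two letters at `p`, where the nine letter pairs are regrouped.
∑-fibers : (p : Pos n) (F : Code q n k → ℤ) →
           (∀ {a b c} → Fiber p a b c → F a + F b + F c ≡ + 0) → (∀ {a} → Single p a → F a ≡ + 0) →
           ∑ (codes q n k) F ≡ + 0
∑-fibers {suc (suc n)} {false} {zero} here F fib sing = trans (∑-codes-false (suc n) 0 F)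
  (trans (ℤ.+-identityʳ _) (trans (∑-codes-false n 0 (F ∘ ○_))
    (trans (ℤ.+-identityʳ _) (∑-0 (codes false n 0) λ t → sing (here○○ t)))))
∑-fibers {suc (suc n)} {false} {suc k} here F fib sing = trans (∑-codes-false (suc n) (suc k) F)
  (trans (cong₂ _+_
    (trans (∑-codes-false n (suc k) (F ∘ ○_)) (cong (_+_ (∑ (codes false n (suc k)) (λ t → F (○ ○ t)))) (∑-starts n k (F ∘ ○_))))
    (trans (∑-starts (suc n) k F)
      (cong₂ _+_ (∑-codes-false n k (F ∘ ●_)) (∑-codes-true n k (F ∘ ●_)))))
  (regroup {∑ (codes false n k) (λ t → F (● ○ t))} {∑ (codes true n k) (λ t → F (● ○ t))}
    (∑-0 (codes false n (suc k)) λ t → sing (here○○ t))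
    (∑-starts-0 n k (F ∘ ●_) λ { _ (starts● t) → sing (here●● t) })
    (∑-triple (codes false n k) _ _ _ λ t → fib (here● t))
    (∑-triple (codes true n k) _ _ _ λ t → fib (here● t))))
∑-fibers {suc (suc n)} {true} {k} here F fib sing = trans (∑-codes-true (suc n) k F)
  (trans (cong₂ _+_ (∑-codes-true n k (F ∘ ○_))
      (cong₂ _+_ (∑-codes-false n k (F ∘ ◐_)) (∑-codes-true n k (F ∘ ◐_))))
  (regroup {∑ (codes false n k) (λ t → F (◐ ○ t))} {∑ (codes true n k) (λ t → F (◐ ○ t))}
    (∑-0 (codes true n k) λ t → sing (here○○ t))
    (∑-starts-0 n k (F ∘ ◐_) λ { _ (starts● t) → sing (here◐● t) })
    (∑-triple (codes false n k) _ _ _ λ t → fib (here◐ t))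
    (∑-triple (codes true n k) _ _ _ λ t → fib (here◐ t))))
∑-fibers {suc n} {false} {zero} (there p) F fib sing = trans (∑-codes-false n 0 F)
  (trans (ℤ.+-identityʳ _) (∑-fibers p (F ∘ ○_) (fib ∘ there○) (sing ∘ there○)))
∑-fibers {suc n} {false} {suc k} (there p) F fib sing = trans (∑-codes-false n (suc k) F)
  (cong₂ _+_ (∑-fibers p (F ∘ ○_) (fib ∘ there○) (sing ∘ there○))
    (trans (∑-starts n k F)
      (cong₂ _+_ (∑-fibers {q = false} p (F ∘ ●_) (fib ∘ there●) (sing ∘ there●))
                 (∑-fibers {q = true} p (F ∘ ●_) (fib ∘ there●) (sing ∘ there●)))))
∑-fibers {suc n} {true} {k} (there p) F fib sing = trans (∑-codes-true n k F)
  (cong₂ _+_ (∑-fibers p (F ∘ ○_) (fib ∘ there○) (sing ∘ there○))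
    (cong₂ _+_ (∑-fibers {q = false} p (F ∘ ◐_) (fib ∘ there◐) (sing ∘ there◐))
               (∑-fibers {q = true} p (F ∘ ◐_) (fib ∘ there◐) (sing ∘ there◐))))

-- Weights and excess

weight : Code q n k → Vec ℕ n
weight ε     = []
weight (○ t) = 0 ∷ weight t
weight (● t) = 1 ∷ weight t
weight (◐ t) = 1 ∷ weight t

excess : Code q n k → ℕ
excess ε     = 0
excess (○ t) = excess t
excess (● t) = excess t
excess (◐ t) = suc (excess t)

wt-empty : (T : Tab n k) → wt (emptyBox n ∷ T) ≡ wt T
wt-empty T = go (wt T)
  where
    go : ∀ {n} (v : Vec ℕ n) → V.zipWith (λ b c → if b then suc c else c) (emptyBox n) v ≡ v
    go []      = refl
    go (c ∷ v) = cong (c ∷_) (go v)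

wt-shift : (T : Tab n k) → wt (shift T) ≡ 0 ∷ wt T
wt-shift []      = refl
wt-shift (A ∷ T) rewrite wt-shift T = refl

wt-decL : (t : Code q n k) → wt (decL t) ≡ weight t
wt-decL ε = refl
wt-decL (○ t) = trans (wt-shift (decL t)) (cong (0 ∷_) (wt-decL t))
-- `dec (● t)` and `decL (◐ t)` are the same tableau.
wt-decL (● t) = trans (wt-empty (dec (● t))) (wt-decL (◐ t))
wt-decL (◐ t) rewrite wt-shift (dec t) = cong (1 ∷_) (wt-decL t)

wt-dec : (t : Code false n k) → wt (dec t) ≡ weight t
wt-dec t = trans (sym (wt-empty (dec t))) (trans (cong wt (sym (decL-false t))) (wt-decL t))

ex-shift : (T : Tab n k) → ex (shift T) ≡ ex T
ex-shift []      = refl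
ex-shift (A ∷ T) = cong (countV A ∸ 1 ℕ.+_) (ex-shift T)

countV-empty : ∀ n → countV (emptyBox n) ≡ 0
countV-empty zero    = refl
countV-empty (suc n) = countV-empty n

-- The box begun outside the word has its minimum there, so all its entries inside count. The total
-- is the number of letters ◐.
ex-decL : (t : Code q n k) → countV (lead t) ℕ.+ ex (dec t) ≡ excess t
ex-decL ε = refl
ex-decL (○ t) rewrite ex-shift (dec t) = ex-decL t
ex-decL (●_ {n = n} t) rewrite ex-shift (dec t) | countV-empty n = ex-decL t
ex-decL (◐ t) rewrite ex-shift (dec t) = cong suc (ex-decL t)

ex-dec : (t : Code false n k) → ex (dec t) ≡ excess t
ex-dec {n} t = trans (cong (ℕ._+ ex (dec t)) (sym (trans (cong countV (lead-empty t)) (countV-empty n)))) (ex-decL t)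

-- Isolates the exponents of xᵢ and xᵢ₊₁, the only ones in which the words of a fiber differ.
put : ∀ {A : Set} → Pos n → A → A → Vec A n → Vec A n
put here      x y (_ ∷ _ ∷ v) = x ∷ y ∷ v
put (there p) x y (a ∷ v)     = a ∷ put p x y v

swapAt-put : ∀ {A : Set} (p : Pos n) (x y : A) v → swapAt p (put p x y v) ≡ put p y x v
swapAt-put here      x y (_ ∷ _ ∷ v) = refl
swapAt-put (there p) x y (a ∷ v)     = cong (a ∷_) (swapAt-put p x y v)

weight-top : {p : Pos n} {a b c : Code q n k} → Fiber p a b c → weight a ≡ put p 1 0 (weight a)
weight-top (here● t)  = refl
weight-top (here◐ t)  = refl
weight-top (there○ x) = cong (0 ∷_) (weight-top x)
weight-top (there● x) = cong (1 ∷_) (weight-top x)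
weight-top (there◐ x) = cong (1 ∷_) (weight-top x)

weight-mid : {p : Pos n} {a b c : Code q n k} → Fiber p a b c → weight b ≡ put p 0 1 (weight a)
weight-mid (here● t)  = refl
weight-mid (here◐ t)  = refl
weight-mid (there○ x) = cong (0 ∷_) (weight-mid x)
weight-mid (there● x) = cong (1 ∷_) (weight-mid x)
weight-mid (there◐ x) = cong (1 ∷_) (weight-mid x)

weight-bot : {p : Pos n} {a b c : Code q n k} → Fiber p a b c → weight c ≡ put p 1 1 (weight a)
weight-bot (here● t)  = refl
weight-bot (here◐ t)  = refl
weight-bot (there○ x) = cong (0 ∷_) (weight-bot x)
weight-bot (there● x) = cong (1 ∷_) (weight-bot x)
weight-bot (there◐ x) = cong (1 ∷_) (weight-bot x)

weight-single : {p : Pos n} {a : Code q n k} → Single p a → ∃ λ x → weight a ≡ put p x x (weight a)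
weight-single (here○○ t) = 0 , refl
weight-single (here●● t) = 1 , refl
weight-single (here◐● t) = 1 , refl
weight-single (there○ s) = proj₁ (weight-single s) , cong (0 ∷_) (proj₂ (weight-single s))
weight-single (there● s) = proj₁ (weight-single s) , cong (1 ∷_) (proj₂ (weight-single s))
weight-single (there◐ s) = proj₁ (weight-single s) , cong (1 ∷_) (proj₂ (weight-single s))

excess-mid : {p : Pos n} {a b c : Code q n k} → Fiber p a b c → excess b ≡ excess a
excess-mid (here● t)  = refl
excess-mid (here◐ t)  = refl
excess-mid (there○ x) = excess-mid x
excess-mid (there● x) = excess-mid x
excess-mid (there◐ x) = cong suc (excess-mid x)

excess-bot : {p : Pos n} {a b c : Code q n k} → Fiber p a b c → excess c ≡ suc (excess a)
excess-bot (here● t)  = refl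
excess-bot (here◐ t)  = refl
excess-bot (there○ x) = excess-bot x
excess-bot (there● x) = excess-bot x
excess-bot (there◐ x) = cong suc (excess-bot x)

-- Linear functionals on polynomials

-- The linear extension of φ to polynomials. Coefficients are the case φ = `δ m`, while products and
-- sᵢ can be absorbed into φ, so polynomial identities reduce to identities on monomials.
ev : (Mono n → ℤ) → Poly n → ℤ
ev φ P = ∑ P λ (c , m) → c * φ m

δ : Mono n → Mono n → ℤ
δ m m′ = if eqMono m′ m then + 1 else + 0

coeff-ev : ∀ P (m : Mono n) → coeff P m ≡ ev (δ m) P
coeff-ev []             m = refl
coeff-ev ((c , m′) ∷ P) m with eqMono m′ m
... | true  = cong₂ _+_ (sym (ℤ.*-identityʳ c)) (coeff-ev P m)
... | false = trans (coeff-ev P m)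
                (trans (sym (ℤ.+-identityˡ _)) (cong (λ z → z + ev (δ m) P) (sym (ℤ.*-zeroʳ c))))

ev-++ : ∀ (φ : Mono n → ℤ) P Q → ev φ (P ⊕ Q) ≡ ev φ P + ev φ Q
ev-++ φ P Q = ∑-++ P Q

ev-neg : ∀ (φ : Mono n → ℤ) P → ev φ (negP P) ≡ - ev φ P
ev-neg φ P = trans (∑-map _ P _)
  (trans (∑-cong P λ (c , m) → sym (ℤ.neg-distribˡ-* c (φ m))) (∑-neg P _))

ev-⊖ : ∀ (φ : Mono n → ℤ) P Q → ev φ (P ⊖ Q) ≡ ev φ P + - ev φ Q
ev-⊖ φ P Q = trans (ev-++ φ P (negP Q)) (cong (_+_ (ev φ P)) (ev-neg φ Q))

sMono : ℕ → Mono n → Mono n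
sMono i (b , a) = b , tabulate₁ _ (λ j → getN (sAct i j) a)

ev-sP : ∀ (φ : Mono n → ℤ) i P → ev φ (sP i P) ≡ ev (φ ∘ sMono i) P
ev-sP φ i P = trans (∑-map _ P _) (∑-cong P λ (c , b , a) → refl)

-- Moves the factor `P` into the functional, so that `Q` remains a plain sum over tableaux.
ev-⊛ : ∀ (φ : Mono n → ℤ) P Q → ev φ (P ⊛ Q) ≡ ev (λ m′ → ev (λ m → φ (mulMono m m′)) P) Q
ev-⊛ φ []            Q = sym (∑-0 Q λ (c , _) → ℤ.*-zeroʳ c)
ev-⊛ φ ((c , m) ∷ P) Q = trans (∑-++ (L.map _ Q) (P ⊛ Q))
  (trans (cong₂ _+_ (∑-map _ Q _) (ev-⊛ φ P Q))
    (trans (sym (∑-+ Q _ _))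
      (∑-cong Q λ (c′ , m′) → lemma c c′ (φ (mulMono m m′)) (ev (λ m → φ (mulMono m m′)) P))))
  where
    lemma : ∀ a b x y → a * b * x + b * y ≡ b * (a * x + y)
    lemma = solve-∀

mono : Code q n k → Mono n
mono t = excess t , weight t

ev-genPoly : ∀ (φ : Mono n → ℤ) w →
  ev φ (genPoly n k w) ≡ ∑ (codes false n k) (λ t → if inDemB w (dec t) then φ (mono t) else + 0)
ev-genPoly {n} {k} φ w = begin
  ev φ (genPoly n k w)
    ≡⟨ monos (SVTw n k w) ⟩
  ∑ (SVTw n k w) (λ T → φ (ex T , wt T))
    ≡⟨ ∑-filterᵇ (inDemB w) (SVT n k) _ ⟩
  ∑ (SVT n k) (λ T → if inDemB w T then φ (ex T , wt T) else + 0)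
    ≡⟨ ∑-↭ _ (SVT-codes n k) ⟩
  ∑ (L.map dec (codes false n k)) (λ T → if inDemB w T then φ (ex T , wt T) else + 0)
    ≡⟨ ∑-map dec (codes false n k) _ ⟩
  ∑ (codes false n k) (λ t → if inDemB w (dec t) then φ (ex (dec t) , wt (dec t)) else + 0)
    ≡⟨ ∑-cong (codes false n k) (λ t →
         cong (λ m → if inDemB w (dec t) then φ m else + 0) (cong₂ _,_ (ex-dec t) (wt-dec t))) ⟩
  ∑ (codes false n k) (λ t → if inDemB w (dec t) then φ (mono t) else + 0) ∎
  where
    open ≡-Reasoning
    monos : ∀ Ts → ev φ (L.foldr _⊕_ [] (L.map (λ T → monoP (ex T) (wt T)) Ts)) ≡
                   ∑ Ts (λ T → φ (ex {n} {k} T , wt T))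
    monos []       = refl
    monos (T ∷ Ts) = cong₂ _+_ (ℤ.*-identityˡ (φ (ex T , wt T))) (monos Ts)

-- The highest weight term

weight-zeros : ∀ n → weight (zeros n) ≡ V.replicate n 0
weight-zeros zero    = refl
weight-zeros (suc n) = cong (0 ∷_) (weight-zeros n)

excess-highest : (h : k ≤ n) → excess (highest h) ≡ 0
excess-highest (z≤n {n}) = go n
  where
    go : ∀ n → excess (zeros n) ≡ 0
    go zero    = refl
    go (suc n) = go n
excess-highest (s≤s h) = excess-highest h

-- The exponent of xᵢ in the product of the xⱼ₊₁ for j in the list; the list counts from 0, the
-- variables from 1.
multiplicity : List ℕ → ℕ → ℕ
multiplicity []       i = 0
multiplicity (j ∷ js) i = (if i ≡ᵇ suc j then 1 else 0) ℕ.+ multiplicity js i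

zipWith-tabulate₁ : ∀ n (F G : ℕ → ℕ) →
  V.zipWith ℕ._+_ (tabulate₁ n F) (tabulate₁ n G) ≡ tabulate₁ n (λ i → F i ℕ.+ G i)
zipWith-tabulate₁ zero    F G = refl
zipWith-tabulate₁ (suc n) F G = cong₂ _∷_ refl (zipWith-tabulate₁ n (F ∘ suc) (G ∘ suc))

product-xP : ∀ n js → L.foldr _⊛_ oneP (L.map (λ j → xP (suc j)) js) ≡
                      monoP {n} 0 (tabulate₁ n (multiplicity js))
product-xP n []       = cong (monoP 0) (sym (tabulate₁-const n 0))
product-xP n (j ∷ js) rewrite product-xP n js = 
  cong (monoP 0) (zipWith-tabulate₁ n (λ i → if i ≡ᵇ suc j then 1 else 0) (multiplicity js))

multiplicity-suc : ∀ js i → multiplicity (L.map suc js) (suc i) ≡ multiplicity js i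
multiplicity-suc []       i = refl
multiplicity-suc (j ∷ js) i = cong (_ ℕ.+_) (multiplicity-suc js i)

multiplicity-suc-0 : ∀ js → multiplicity (L.map suc js) 1 ≡ 0
multiplicity-suc-0 []       = refl
multiplicity-suc-0 (j ∷ js) = multiplicity-suc-0 js

weight-highest : (h : k ≤ n) → tabulate₁ n (multiplicity (upTo k)) ≡ weight (highest h)
weight-highest (z≤n {n}) = trans (tabulate₁-const n 0) (sym (weight-zeros n))
weight-highest {suc k} {suc n} (s≤s h) rewrite sym (L.map-upTo suc k) = cong₂ _∷_
  (cong suc (multiplicity-suc-0 (upTo k)))
  (trans (V.tabulate-cong (λ i → multiplicity-suc (upTo k) (suc (toℕ i)))) (weight-highest h))

xProd-highest : (h : k ≤ n) → xProd {n} k ≡ monoP 0 (weight (highest h))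
xProd-highest {k} {n} h = trans (product-xP n (upTo k)) (cong (monoP 0) (weight-highest h))

genPoly-[] : k ≤ n → genPoly n k [] ≈ xProd k
genPoly-[] {k} {n} h m = begin
  coeff (genPoly n k []) m
    ≡⟨ coeff-ev (genPoly n k []) m ⟩
  ev (δ m) (genPoly n k [])
    ≡⟨ ev-genPoly (δ m) [] ⟩
  ∑ (codes false n k) (λ t → if eqTab (dec t) u then δ m (mono t) else + 0)
    ≡⟨ ∑-single (codes-unique false n k) (codes-complete (highest h)) others ⟩
  (if eqTab (dec (highest h)) u then δ m (mono (highest h)) else + 0)
    ≡⟨ cong (λ T → if eqTab T u then δ m (mono (highest h)) else + 0) (dec-highest h) ⟩
  (if eqTab (u {n} {k}) u then δ m (mono (highest h)) else + 0)
    ≡⟨ cong (if_then δ m (mono (highest h)) else + 0) (eqTab-refl {n} {k} u) ⟩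
  δ m (mono (highest h))
    ≡⟨ cong (λ b → δ m (b , weight (highest h))) (excess-highest h) ⟩
  δ m (0 , weight (highest h))
    ≡⟨ sym (trans (ℤ.+-identityʳ _) (ℤ.*-identityˡ _)) ⟩
  ev (δ m) (monoP 0 (weight (highest h)))
    ≡⟨ cong (ev (δ m)) (sym (xProd-highest h)) ⟩
  ev (δ m) (xProd k)
    ≡⟨ sym (coeff-ev (xProd k) m) ⟩
  coeff (xProd k) m ∎
  where
    open ≡-Reasoning
    others : ∀ t → ¬ t ≡ highest h → (if eqTab (dec t) u then δ m (mono t) else + 0) ≡ + 0
    others t t≢ with eqTab (dec t) u in eq
    ... | false = refl
    ... | true  = contradiction (dec-injective (trans (eqTab-sound (dec t) u eq) (sym (dec-highest h)))) t≢

-- The Demazure–Lascoux recursion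

varVec : ∀ n → ℕ → Vec ℕ n
varVec n j = tabulate₁ n (λ i → if i ≡ᵇ j then 1 else 0)

zeros+ : (v : Vec ℕ n) → V.zipWith ℕ._+_ (tabulate₁ n (λ _ → 0)) v ≡ v
zeros+ {n} v = trans (cong (λ z → V.zipWith ℕ._+_ z v) (tabulate₁-const n 0)) (V.zipWith-identityˡ ℕ.+-identityˡ v)

mul-xᵢ : (p : Pos n) (x y : ℕ) (v : Vec ℕ n) →
         V.zipWith ℕ._+_ (varVec n (pos p)) (put p x y v) ≡ put p (suc x) y v
mul-xᵢ here      x y (_ ∷ _ ∷ v) = cong (λ v → suc x ∷ y ∷ v) (zeros+ v)
mul-xᵢ (there p) x y (a ∷ v)     = cong (a ∷_) (mul-xᵢ p x y v)

mul-xᵢ₊₁ : (p : Pos n) (x y : ℕ) (v : Vec ℕ n) →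
           V.zipWith ℕ._+_ (varVec n (suc (pos p))) (put p x y v) ≡ put p x (suc y) v
mul-xᵢ₊₁ here      x y (_ ∷ _ ∷ v) = cong (λ v → x ∷ suc y ∷ v) (zeros+ v)
mul-xᵢ₊₁ (there p) x y (a ∷ v)     = cong (a ∷_) (mul-xᵢ₊₁ p x y v)

mul-βxᵢxᵢ₊₁ : (p : Pos n) (x y : ℕ) (v : Vec ℕ n) →
  V.zipWith ℕ._+_ (V.zipWith ℕ._+_ (V.zipWith ℕ._+_ (V.replicate n 0) (varVec n (pos p)))
                                    (varVec n (suc (pos p)))) (put p x y v) ≡
  put p (suc x) (suc y) v
mul-βxᵢxᵢ₊₁ {n} p x y v = begin
  ((V.replicate n 0 ⊞ varVec n (pos p)) ⊞ varVec n (suc (pos p))) ⊞ put p x y v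
    ≡⟨ cong (λ z → (z ⊞ varVec n (suc (pos p))) ⊞ put p x y v) (V.zipWith-identityˡ ℕ.+-identityˡ _) ⟩
  (varVec n (pos p) ⊞ varVec n (suc (pos p))) ⊞ put p x y v
    ≡⟨ V.zipWith-assoc ℕ.+-assoc (varVec n (pos p)) _ _ ⟩
  varVec n (pos p) ⊞ (varVec n (suc (pos p)) ⊞ put p x y v)
    ≡⟨ cong (varVec n (pos p) ⊞_) (mul-xᵢ₊₁ p x y v) ⟩
  varVec n (pos p) ⊞ put p x (suc y) v
    ≡⟨ mul-xᵢ p x (suc y) v ⟩
  put p (suc x) (suc y) v ∎
  where
    open ≡-Reasoning
    _⊞_ : Vec ℕ n → Vec ℕ n → Vec ℕ n
    _⊞_ = V.zipWith ℕ._+_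

tabulate₁-getN : (v : Vec ℕ n) → tabulate₁ n (λ j → getN j v) ≡ v
tabulate₁-getN []      = refl
tabulate₁-getN (a ∷ v) = cong (a ∷_) (tabulate₁-getN v)

sMono-put : ∀ (p : Pos n) b x y v → sMono (pos p) (b , put p x y v) ≡ (b , put p y x v)
sMono-put {n} p b x y v = cong (b ,_) (trans (tabulate₁-sAct p (λ j → getN j (put p x y v)))
  (trans (cong (swapAt p) (tabulate₁-getN (put p x y v))) (swapAt-put p x y v)))

module _ {n} (p : Pos n) (φ : Mono n → ℤ) where

  private
    i : ℕ
    i = pos p

  -- φ(m (xᵢ − xᵢ₊₁)) and φ((1 − sᵢ)(m (xᵢ + β xᵢ xᵢ₊₁)))
  dvd num : Mono n → ℤ
  dvd m = ev (λ m′ → φ (mulMono m′ m)) (xP i ⊖ xP (suc i))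
  num m = ev (λ m′ → φ (mulMono m′ m)) (xP i ⊕ βP ⊛ xP i ⊛ xP (suc i)) +
          - ev (λ m′ → φ (sMono i (mulMono m′ m))) (xP i ⊕ βP ⊛ xP i ⊛ xP (suc i))

  module _ (v : Vec ℕ n) where

    at : ℕ → ℕ → ℕ → ℤ
    at b x y = φ (b , put p x y v)

    dvd-put : ∀ b x y → dvd (b , put p x y v) ≡ at b (suc x) y + - at b x (suc y)
    dvd-put b x y rewrite mul-xᵢ p x y v | mul-xᵢ₊₁ p x y v = lemma (at b (suc x) y) (at b x (suc y))
      where
        lemma : ∀ a c → + 1 * a + (- (+ 1) * c + + 0) ≡ a + - c
        lemma = solve-∀

    num-put : ∀ b x y → num (b , put p x y v) ≡
      (at b (suc x) y + at (suc b) (suc x) (suc y)) + - (at b y (suc x) + at (suc b) (suc y) (suc x))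
    num-put b x y
      rewrite mul-xᵢ p x y v | mul-βxᵢxᵢ₊₁ p x y v
            | sMono-put p b (suc x) y v | sMono-put p (suc b) (suc x) (suc y) v =
      lemma (at b (suc x) y) (at (suc b) (suc x) (suc y)) (at b y (suc x)) (at (suc b) (suc y) (suc x))
      where
        lemma : ∀ a c a′ c′ →
          (+ 1 * a + (+ 1 * c + + 0)) + - (+ 1 * a′ + (+ 1 * c′ + + 0)) ≡ (a + c) + - (a′ + c′)
        lemma = solve-∀

    -- ϖᵢ fixes monomials symmetric in xᵢ and xᵢ₊₁: the contribution of β xᵢ xᵢ₊₁ cancels.
    dvd-num-single : ∀ b x → dvd (b , put p x x v) ≡ num (b , put p x x v)
    dvd-num-single b x = trans (dvd-put b x x) (trans
      (lemma (at b (suc x) x) (at b x (suc x)) (at (suc b) (suc x) (suc x))) (sym (num-put b x x)))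
      where
        lemma : ∀ a c d → a + - c ≡ (a + d) + - (c + d)
        lemma = solve-∀

    -- ϖᵢ(xᵢ) = xᵢ + xᵢ₊₁ + β xᵢ xᵢ₊₁
    dvd-num-fiber : ∀ b → dvd (b , put p 1 0 v) + dvd (b , put p 0 1 v) + dvd (suc b , put p 1 1 v) ≡
                          num (b , put p 1 0 v)
    dvd-num-fiber b rewrite dvd-put b 1 0 | dvd-put b 0 1 | dvd-put (suc b) 1 1 | num-put b 1 0 =
      lemma (at b 2 0) (at b 1 1) (at b 0 2) (at (suc b) 2 1) (at (suc b) 1 2)
      where
        lemma : ∀ a c d a′ c′ → (a + - c) + (c + - d) + (a′ + - c′) ≡ (a + a′) + - (d + c′)
        lemma = solve-∀

    -- ϖᵢ(xᵢ₊₁ + β xᵢ xᵢ₊₁) = 0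
    num-lower-fiber : ∀ b → num (b , put p 0 1 v) + num (suc b , put p 1 1 v) ≡ + 0
    num-lower-fiber b rewrite num-put b 0 1 | num-put (suc b) 1 1 =
      lemma (at b 1 1) (at (suc b) 1 2) (at (suc b) 2 1) (at (suc (suc b)) 2 2)
      where
        lemma : ∀ a c d f → ((a + c) + - (a + d)) + ((d + f) + - (c + f)) ≡ + 0
        lemma = solve-∀

-- Brings an equality of sums into the form to which `∑-fibers` applies.
∑-difference : ∀ {A : Set} xs (F G : A → ℤ) → ∑ xs (λ x → F x + - G x) ≡ + 0 → ∑ xs F ≡ ∑ xs G
∑-difference xs F G eq = ℤ.i-j≡0⇒i≡j _ _
  (trans (cong (_+_ (∑ xs F)) (sym (∑-neg xs G))) (trans (sym (∑-+ xs F (λ x → - G x))) eq))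

-- `d` stands for membership of the top word in the crystal of w, which equals membership of each
-- word of the fiber in that of sᵢw; `d′` stands for membership of the lower two words in that of w.
fiber-difference : ∀ (d d′ : Bool) {A B C A′ B′ C′ : ℤ} → A + B + C ≡ A′ → B′ + C′ ≡ + 0 →
  ((if d then A else + 0) + - (if d then A′ else + 0)) +
  ((if d then B else + 0) + - (if d′ then B′ else + 0)) +
  ((if d then C else + 0) + - (if d′ then C′ else + 0)) ≡ + 0
fiber-difference d d′ {A} {B} {C} {_} {B′} {C′} refl eq = go d d′
  where
    lemma₁ : ∀ a b c → a + - (a + b + c) + (b + + 0) + (c + + 0) ≡ + 0
    lemma₁ = solve-∀
    lemma₂ : ∀ a b c b′ c′ → a + - (a + b + c) + (b + - b′) + (c + - c′) ≡ - (b′ + c′)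
    lemma₂ = solve-∀
    lemma₃ : ∀ b′ c′ → + 0 + (+ 0 + - b′) + (+ 0 + - c′) ≡ - (b′ + c′)
    lemma₃ = solve-∀
    go : ∀ d d′ →
      ((if d then A else + 0) + - (if d then A + B + C else + 0)) +
      ((if d then B else + 0) + - (if d′ then B′ else + 0)) +
      ((if d then C else + 0) + - (if d′ then C′ else + 0)) ≡ + 0
    go false false = refl
    go true  false = lemma₁ A B C
    go true  true  = trans (lemma₂ A B C B′ C′) (cong -_ eq)
    go false true  = trans (lemma₃ B′ C′) (cong -_ eq)

-- The defining equation of ϖᵢ after applying φ, with both sides compared fiber by fiber.
dem-sum : (p : Pos n) (φ : Mono n → ℤ) → ∀ {w} → k ≤ n → Reduced n (pos p ∷ w) →
  ∑ (codes false n k) (λ t → if inDemB (pos p ∷ w) (dec t) then dvd p φ (mono t) else + 0) ≡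
  ∑ (codes false n k) (λ t → if inDemB w (dec t) then num p φ (mono t) else + 0)
dem-sum {n} {k} p φ {w} h red = ∑-difference (codes false n k) _ _ (∑-fibers p _ fib sing)
  where
    H : Code false n k → ℤ
    H t = (if inDemB (pos p ∷ w) (dec t) then dvd p φ (mono t) else + 0) +
          - (if inDemB w (dec t) then num p φ (mono t) else + 0)

    fib : ∀ {a b c} → Fiber p a b c → H a + H b + H c ≡ + 0
    fib {a} {b} {c} x
      rewrite lower-top x | lower-mid x | lower-bot x
            | demazure-cong {v = w} {w} h (reduced-tail red) (reduced-tail red) b c refl (maxima-mid-bot x)
            | excess-mid x | excess-bot x | weight-mid x | weight-bot x =
      fiber-difference (inDemB w (dec a)) (inDemB w (dec c))
        -- The right side of `weight-top` contains `weight a` again, so `subst` selects the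
        -- occurrences to be replaced.
        (subst (λ v → dvd p φ (excess a , v) + dvd p φ (excess a , put p 0 1 (weight a))
                        + dvd p φ (suc (excess a) , put p 1 1 (weight a)) ≡ num p φ (excess a , v))
               (sym (weight-top x)) (dvd-num-fiber p φ (weight a) (excess a)))
        (num-lower-fiber p φ (weight a) (excess a))

    sing : ∀ {a} → Single p a → H a ≡ + 0
    sing {a} s with weight-single s
    ... | x , eq rewrite lower-single s
      | subst (λ v → dvd p φ (excess a , v) ≡ num p φ (excess a , v)) (sym eq)
              (dvd-num-single p φ (weight a) (excess a) x) =
      ℤ.+-inverseʳ (if inDemB w (dec a) then num p φ (mono a) else + 0)

-- Each coefficient is a functional `δ m`. Absorbing the factor xᵢ - xᵢ₊₁ on one side, and xᵢ + β xᵢ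
-- xᵢ₊₁ with 1 - sᵢ on the other, turns it into `dvd` and `num`.
isVarpi-genPoly : (p : Pos n) → ∀ {w} → k ≤ n → Reduced n (pos p ∷ w) →
                  IsVarpi (pos p) (genPoly n k w) (genPoly n k (pos p ∷ w))
isVarpi-genPoly {n} {k} p {w} h red m = begin
  coeff ((xP i ⊖ xP (suc i)) ⊛ genPoly n k (i ∷ w)) m
    ≡⟨ coeff-ev ((xP i ⊖ xP (suc i)) ⊛ genPoly n k (i ∷ w)) m ⟩
  ev (δ m) ((xP i ⊖ xP (suc i)) ⊛ genPoly n k (i ∷ w))
    ≡⟨ ev-⊛ (δ m) (xP i ⊖ xP (suc i)) (genPoly n k (i ∷ w)) ⟩
  ev (dvd p (δ m)) (genPoly n k (i ∷ w))
    ≡⟨ ev-genPoly (dvd p (δ m)) (i ∷ w) ⟩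
  ∑ (codes false n k) (λ t → if inDemB (i ∷ w) (dec t) then dvd p (δ m) (mono t) else + 0)
    ≡⟨ dem-sum p (δ m) h red ⟩
  ∑ (codes false n k) (λ t → if inDemB w (dec t) then num p (δ m) (mono t) else + 0)
    ≡⟨ sym (ev-genPoly (num p (δ m)) w) ⟩
  ev (num p (δ m)) G
    ≡⟨ ev-difference _ _ G ⟩
  ev (λ m₁ → ev (λ m₂ → δ m (mulMono m₂ m₁)) P) G + - ev (λ m₁ → ev (λ m₂ → δ m (sMono i (mulMono m₂ m₁))) P) G
    ≡⟨ sym (cong₂ (λ a b → a + - b) (ev-⊛ (δ m) P G)
                   (trans (ev-sP (δ m) i F) (ev-⊛ (δ m ∘ sMono i) P G))) ⟩
  ev (δ m) F + - ev (δ m) (sP i F)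
    ≡⟨ sym (ev-⊖ (δ m) F (sP i F)) ⟩
  ev (δ m) (F ⊖ sP i F)
    ≡⟨ sym (coeff-ev (F ⊖ sP i F) m) ⟩
  coeff (F ⊖ sP i F) m ∎
  where
    open ≡-Reasoning
    i : ℕ
    i = pos p
    G P F : Poly n
    G = genPoly n k w
    P = xP i ⊕ βP ⊛ xP i ⊛ xP (suc i)
    F = P ⊛ G
    ev-difference : ∀ (φ ψ : Mono n → ℤ) Q → ev (λ m → φ m + - ψ m) Q ≡ ev φ Q + - ev ψ Q
    ev-difference φ ψ Q = trans (∑-cong Q λ (c , m) → lemma c (φ m) (ψ m))
      (trans (∑-+ Q _ _) (cong (_+_ (ev φ Q)) (∑-neg Q _)))
      where
        lemma : ∀ c x y → c * (x + - y) ≡ c * x + - (c * y)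
        lemma = solve-∀

-- The suffixes of w are reduced as well, and their generating functions are the intermediate
-- polynomials of the chain.
genPoly-chain : k ≤ n → ∀ w → Reduced n w → DLChain w (xProd k) (genPoly n k w)
genPoly-chain h []      red = genPoly-[] h
genPoly-chain {k} {n} h (i ∷ w) red@((1≤i , i<n) ∷ _ , _) with position 1≤i i<n
... | p , refl = genPoly n k w , genPoly-chain h w (reduced-tail red) , isVarpi-genPoly p h red

k3 : k ≤ n → K3 n k
k3 {k} {n} h w red = genPoly n k w , genPoly-chain h w red , λ m → refl

theorem7p9 : (n k : ℕ) → 2 ≤ n → 1 ≤ k → k ≤ n → K1 n k × K2 n k × K3 n k
theorem7p9 n k _ _ h = k1 h , k2 h , k3 h
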